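{- The tautologies $STSEQ(n)$ have polynomial size $AC^0$-Frege proofs.
   Context: $STSEQ(n)$ is the family of propositional tautologies expressing the st-connectivity principle on the $n\times n$ grid graph when the two paths are given as sequences of edges: for each edge slot $e$ of the grid and each $1\le i\le n^2$ there are propositional variables $b_{e,i}$ and $r_{e,i}$ asserting that $e$ is the $i$-th edge of the blue path, resp. of the red path. The tautology (obtained as the standard propositional translation of the corresponding bounded formula) states that if the blue variables encode a sequence of edges forming a path joining one pair of diagonally opposite corners and the red variables encode a sequence of edges forming a path joining the other pair of opposite corners, then the two paths share a grid point. An $AC^0$-Frege (constant-depth Frege) system is a Frege system whose proof lines are formulas with unbounded fan-in $\wedge,\vee$ of depth at most a fixed constant $d$; polynomial size means size bounded by a polynomial in $n$. -}

module Defs where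

open import Data.Nat using (ℕ; zero; suc; _+_; _*_; _∸_; _⊔_; _≡ᵇ_; _<ᵇ_)
open import Data.Bool using (Bool; true; false; if_then_else_; _∧_; _∨_; not)
open import Data.List using (List; []; _∷_; [_]; map; concatMap; upTo; _++_)
open import Data.Product using (_×_; _,_; Σ; proj₁; proj₂)
open import Data.List.Membership.Propositional using (_∈_)
open import Data.List.Relation.Unary.All using (All)

-- Propositional formulas with unbounded fan-in ∧ / ∨, in negation
-- normal form (negations only on atoms).  ⋀ [] is "true", ⋁ [] "false".

data Form (A : Set) : Set where
  pos neg : A → Form A
  ⋀ ⋁     : List (Form A) → Form A

mutual
  dual : ∀ {A} → Form A → Form A
  dual (pos a) = neg a
  dual (neg a) = pos a
  dual (⋀ φs)  = ⋁ (dualL φs)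
  dual (⋁ φs)  = ⋀ (dualL φs)

  dualL : ∀ {A} → List (Form A) → List (Form A)
  dualL []       = []
  dualL (φ ∷ φs) = dual φ ∷ dualL φs

mutual
  depth : ∀ {A} → Form A → ℕ
  depth (pos _) = 0
  depth (neg _) = 0
  depth (⋀ φs)  = suc (depthL φs)
  depth (⋁ φs)  = suc (depthL φs)

  depthL : ∀ {A} → List (Form A) → ℕ
  depthL []       = 0
  depthL (φ ∷ φs) = depth φ ⊔ depthL φs

mutual
  size : ∀ {A} → Form A → ℕ
  size (pos _) = 1
  size (neg _) = 1
  size (⋀ φs)  = suc (sizeL φs)
  size (⋁ φs)  = suc (sizeL φs)

  sizeL : ∀ {A} → List (Form A) → ℕ
  sizeL []       = 0
  sizeL (φ ∷ φs) = size φ + sizeL φs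

-- The proof system: Tait-style (one-sided sequent) Frege system with
-- unbounded fan-in connectives and cut.  Proofs are dag-like: a proof is
-- a sequence of lines (sequents), each inferred from earlier lines.

Seq : Set → Set
Seq A = List (Form A)

data Infers {A : Set} (L : List (Seq A)) : Seq A → Set where
  axiom : ∀ {Γ a} → pos a ∈ Γ → neg a ∈ Γ → Infers L Γ
  weak  : ∀ {Γ Δ} → Γ ∈ L → (∀ {φ} → φ ∈ Γ → φ ∈ Δ) → Infers L Δ
  and-i : ∀ {Γ φs} → All (λ φ → (φ ∷ Γ) ∈ L) φs → Infers L (⋀ φs ∷ Γ)
  or-i  : ∀ {Γ φ φs} → φ ∈ φs → (φ ∷ Γ) ∈ L → Infers L (⋁ φs ∷ Γ)
  cut   : ∀ {Γ φ} → (φ ∷ Γ) ∈ L → (dual φ ∷ Γ) ∈ L → Infers L Γ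

-- Lines ls : ls is a correct proof sequence, written last line first.
data Lines {A : Set} : List (Seq A) → Set where
  []  : Lines []
  _∷_ : ∀ {S L} → Infers L S → Lines L → Lines (S ∷ L)

record Proof {A : Set} (φ : Form A) : Set where
  constructor proof
  field
    earlier : List (Seq A)
    valid   : Lines ([ φ ] ∷ earlier)

  lines : List (Seq A)
  lines = [ φ ] ∷ earlier

seqDepth : ∀ {A} → Seq A → ℕ
seqDepth = depthL

seqSize : ∀ {A} → Seq A → ℕ
seqSize Γ = suc (sizeL Γ)

linesDepth : ∀ {A} → List (Seq A) → ℕ
linesDepth []       = 0
linesDepth (S ∷ Ss) = seqDepth S ⊔ linesDepth Ss

linesSize : ∀ {A} → List (Seq A) → ℕ
linesSize []       = 0
linesSize (S ∷ Ss) = seqSize S + linesSize Ss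

proofDepth : ∀ {A} {φ : Form A} → Proof φ → ℕ
proofDepth π = linesDepth (Proof.lines π)

proofSize : ∀ {A} {φ : Form A} → Proof φ → ℕ
proofSize π = linesSize (Proof.lines π)

Point : Set
Point = ℕ × ℕ

data Edge : Set where
  hor ver : ℕ → ℕ → Edge

endpoints : Edge → Point × Point
endpoints (hor x y) = (x , y) , (suc x , y)
endpoints (ver x y) = (x , y) , (x , suc y)

_=ᵖ_ : Point → Point → Bool
(x , y) =ᵖ (x' , y') = (x ≡ᵇ x') ∧ (y ≡ᵇ y')

incident : Point → Edge → Bool
incident p e with endpoints e
... | (u , v) = (p =ᵖ u) ∨ (p =ᵖ v)

shareVertex : Edge → Edge → Bool
shareVertex e e' with endpoints e
... | (u , v) = incident u e' ∨ incident v e'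

keep : ∀ {X : Set} → (X → Bool) → List X → List X
keep f []       = []
keep f (x ∷ xs) = if f x then x ∷ keep f xs else keep f xs

points : ℕ → List Point
points n = concatMap (λ x → map (λ y → x , y) (upTo n)) (upTo n)

edges : ℕ → List Edge
edges n =
  concatMap (λ x → map (hor x) (upTo n)) (upTo (n ∸ 1)) ++
  concatMap (λ x → map (ver x) (upTo (n ∸ 1))) (upTo n)

positions : ℕ → List ℕ
positions n = map suc (upTo (n * n))

distinctPairs : ∀ {X : Set} → List X → List (X × X)
distinctPairs []       = []
distinctPairs (x ∷ xs) = map (λ y → x , y) xs ++ distinctPairs xs

-- Variables of STSEQ(n): b e i ("e is the i-th edge of the blue path"),
-- r e i ("e is the i-th edge of the red path").

data Atom : Set where
  b r : Edge → ℕ → Atom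

module _ (n : ℕ) (col : Edge → ℕ → Atom) where

  innerPositions : List ℕ
  innerPositions = map suc (upTo (n * n ∸ 1))

  occ : ℕ → Form Atom
  occ i = ⋁ (map (λ e → pos (col e i)) (edges n))

  occNext : ℕ → Form Atom
  occNext i = if i <ᵇ (n * n) then occ (suc i) else ⋁ []

  -- "col encodes a sequence of edges e₁ … e_k (1 ≤ k ≤ n²) forming a
  --  path from s to t"
  isPath : Point → Point → Form Atom
  isPath s t = ⋀ (
    concatMap (λ i → map (λ ee → ⋁ (neg (col (proj₁ ee) i) ∷
                                     neg (col (proj₂ ee) i) ∷ []))
                         (distinctPairs (edges n)))
              (positions n) ++
    occ 1 ∷
    map (λ i → ⋁ (dual (occ (suc i)) ∷ occ i ∷ [])) innerPositions ++
    map (λ e → neg (col e 1)) (keep (λ e → not (incident s e)) (edges n)) ++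
    concatMap (λ i → concatMap (λ e →
        map (λ e' → ⋁ (neg (col e i) ∷ neg (col e' (suc i)) ∷ []))
            (keep (λ e' → not (shareVertex e e')) (edges n)))
        (edges n))
      innerPositions ++
    -- the last edge contains t
    concatMap (λ i → map (λ e → ⋁ (neg (col e i) ∷ occNext i ∷ []))
                         (keep (λ e → not (incident t e)) (edges n)))
              (positions n))

sharePoint : ℕ → Form Atom
sharePoint n = ⋁ (
  concatMap (λ p →
    concatMap (λ e → concatMap (λ e' → concatMap (λ i → map (λ j →
        ⋀ (pos (b e i) ∷ pos (r e' j) ∷ []))
      (positions n)) (positions n))
      (keep (incident p) (edges n)))
      (keep (incident p) (edges n)))
    (points n))

STSEQ : ℕ → Form Atom
STSEQ n = ⋁ (dual (isPath n b (0 , 0) (n ∸ 1 , n ∸ 1)) ∷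
             dual (isPath n r (0 , n ∸ 1) (n ∸ 1 , 0)) ∷
             sharePoint n ∷ [])

{-# OPTIONS --safe #-}

-- The walks need not be simple, so no path is extracted from them.  Instead, by induction on m, there are
-- no blue and red subwalks in the region x < m which both end on the last column of this region and whose
-- ends interleave there.  In the step from m to m + 1, each of the two subwalks is composed of single
-- edges on the new column and of excursions to the old region.  A piece of the red walk does not interleave
-- with any piece of the blue walk, so all points of the blue walk on the new column lie on the same side of
-- it; hence no red piece interleaves with the whole blue subwalk, and for the same reason the red subwalk
-- does not either.  All the predicates in these inductions are of constant depth.  At last the two walks are
-- extended by a frame around the grid, after which all four ends lie on the last column and interleave.

module Submission where

open import Defs
open import Data.Nat
  using (ℕ; zero; suc; _+_; _*_; _∸_; _^_; _≤_; _<_; _⊔_; _≡ᵇ_; _<ᵇ_; z≤n; s≤s; NonZero; >-nonZero; _≟_; _≤?_; _<?_)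
open import Data.Nat.Properties
open import Data.Nat.Solver using (module +-*-Solver)
open import Data.Bool using (Bool; true; false; not; _xor_; T)
import Data.Bool.Properties as Bool
open import Data.Empty using (⊥; ⊥-elim)
open import Data.Unit using (tt)
open import Data.Product using (Σ; ∃; _×_; _,_; proj₁; proj₂)
open import Data.Sum using (_⊎_; inj₁; inj₂)
open import Data.List using (List; []; _∷_; [_]; _++_; map; concatMap; upTo; length; cartesianProduct)
open import Data.List.Properties using (length-map; length-++; length-upTo)
open import Data.List.Membership.Propositional using (_∈_; find; lose)
open import Data.List.Membership.Propositional.Properties
  using (∈-map⁺; ∈-map⁻; ∈-++⁺ˡ; ∈-++⁺ʳ; ∈-++⁻; ∈-upTo⁺; ∈-upTo⁻; ∈-cartesianProduct⁺; ∈-cartesianProduct⁻; ∈-concatMap⁺; ∈-concatMap⁻)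
open import Data.List.Relation.Binary.Subset.Propositional using (_⊆_)
open import Data.List.Relation.Unary.Any using (here; there)
open import Data.List.Relation.Unary.All as All using (All; []; _∷_)
import Data.List.Relation.Unary.All.Properties as All
open import Function using (_∘_; id)
open import Function.Bundles using (Equivalence)
open import Relation.Nullary using (¬_; Dec; yes; no)
open import Relation.Nullary.Decidable using (_×-dec_; _⊎-dec_)
open import Relation.Binary.PropositionalEquality
  using (_≡_; _≢_; refl; sym; trans; cong; cong₂; subst)

-- An argument that counts crossings modulo 2 is out of reach: the parity of unboundedly many bits
-- has no polynomial-size formulas of constant depth. Here parity is only taken over the four
-- heights at the ends of two subwalks. These are indices, not truth values, so interleaving is
-- decided while a formula is written down and costs no depth. What formulas have to express is that
-- at each time of an interval some edge of a given region is used, and where the new column was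
-- last visited. The size stays polynomial because the inductions are nested to a fixed depth: over
-- the columns, inside it over the time of the red subwalk, and inside that over the time of the
-- blue one. The claim about the old region is a single formula about all pairs of subwalks, so both
-- inner inductions use it as a hypothesis, and each level of nesting multiplies the number of lines
-- by a polynomial factor only.

variable
  A X : Set
  h k m : ℕ
  φ ψ : Form A
  φs Γ Δ : List (Form A)

-- Duals, and formulas of bounded depth and fan-in

mutual
  dual-involutive : (φ : Form A) → dual (dual φ) ≡ φ
  dual-involutive (pos a) = refl
  dual-involutive (neg a) = refl
  dual-involutive (⋀ φs) = cong ⋀ (dualL-involutive φs)
  dual-involutive (⋁ φs) = cong ⋁ (dualL-involutive φs)

  dualL-involutive : (φs : List (Form A)) → dualL (dualL φs) ≡ φs
  dualL-involutive [] = refl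
  dualL-involutive (φ ∷ φs) = cong₂ _∷_ (dual-involutive φ) (dualL-involutive φs)

∈-dualL⁺ : φ ∈ φs → dual φ ∈ dualL φs
∈-dualL⁺ (here refl) = here refl
∈-dualL⁺ (there i) = there (∈-dualL⁺ i)

∈-dualL⁻ : (φs : List (Form A)) → ψ ∈ dualL φs → ∃ λ φ → φ ∈ φs × ψ ≡ dual φ
∈-dualL⁻ (φ ∷ φs) (here refl) = φ , here refl , refl
∈-dualL⁻ (φ ∷ φs) (there i) with ∈-dualL⁻ φs i
... | χ , j , eq = χ , there j , eq

length-dualL : (φs : List (Form A)) → length (dualL φs) ≡ length φs
length-dualL [] = refl
length-dualL (φ ∷ φs) = cong suc (length-dualL φs)

-- Formulas of depth at most h in which every connective has fewer than W arguments.
data Bounded {A : Set} (W : ℕ) : ℕ → Form A → Set where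
  pos : ∀ {h a} → Bounded W h (pos a)
  neg : ∀ {h a} → Bounded W h (neg a)
  ⋀   : ∀ {h φs} → length φs < W → (∀ {φ} → φ ∈ φs → Bounded W h φ) → Bounded W (suc h) (⋀ φs)
  ⋁   : ∀ {h φs} → length φs < W → (∀ {φ} → φ ∈ φs → Bounded W h φ) → Bounded W (suc h) (⋁ φs)

module _ {W : ℕ} where

  Bounded-dual : Bounded W h φ → Bounded W h (dual φ)
  Bounded-dual pos = neg
  Bounded-dual neg = pos
  Bounded-dual (⋀ {φs = φs} l β) = ⋁ (subst (_< W) (sym (length-dualL φs)) l) go
    where
    go : ψ ∈ dualL φs → Bounded W _ ψ
    go i with ∈-dualL⁻ φs i
    ... | φ , j , refl = Bounded-dual (β j)
  Bounded-dual (⋁ {φs = φs} l β) = ⋀ (subst (_< W) (sym (length-dualL φs)) l) go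
    where
    go : ψ ∈ dualL φs → Bounded W _ ψ
    go i with ∈-dualL⁻ φs i
    ... | φ , j , refl = Bounded-dual (β j)

  Bounded-mono : h ≤ k → Bounded W h φ → Bounded W k φ
  Bounded-mono _ pos = pos
  Bounded-mono _ neg = neg
  Bounded-mono (s≤s h≤k) (⋀ l β) = ⋀ l (λ i → Bounded-mono h≤k (β i))
  Bounded-mono (s≤s h≤k) (⋁ l β) = ⋁ l (λ i → Bounded-mono h≤k (β i))

  ⋀-argument : Bounded W h (⋀ φs) → φ ∈ φs → Bounded W h φ
  ⋀-argument (⋀ _ β) i = Bounded-mono (n≤1+n _) (β i)

  ⋁-argument : Bounded W h (⋁ φs) → φ ∈ φs → Bounded W h φ
  ⋁-argument (⋁ _ β) i = Bounded-mono (n≤1+n _) (β i)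

  ⋁-width : Bounded W h (⋁ φs) → length φs < W
  ⋁-width (⋁ l _) = l

  mutual
    depth-Bounded : Bounded W h φ → depth φ ≤ h
    depth-Bounded pos = z≤n
    depth-Bounded neg = z≤n
    depth-Bounded (⋀ {φs = φs} _ β) = s≤s (depthL-Bounded φs β)
    depth-Bounded (⋁ {φs = φs} _ β) = s≤s (depthL-Bounded φs β)

    depthL-Bounded : (φs : List (Form A)) → (∀ {φ} → φ ∈ φs → Bounded W h φ) → depthL φs ≤ h
    depthL-Bounded [] β = z≤n
    depthL-Bounded (φ ∷ φs) β =
      ⊔-lub (depth-Bounded (β (here refl))) (depthL-Bounded φs (λ i → β (there i)))

  module _ {{_ : NonZero W}} where

    -- The strictness of `l < W` pays for the connective: its own symbol fits into the one spare
    -- summand `W ^ h`.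
    size-step : ∀ h l s → l < W → s ≤ l * W ^ h → suc s ≤ W ^ suc h
    size-step h l s l<W le = begin
      suc s               ≤⟨ +-mono-≤ (m^n>0 W h) le ⟩
      W ^ h + l * W ^ h   ≤⟨ *-monoˡ-≤ (W ^ h) l<W ⟩
      W * W ^ h           ∎
      where open ≤-Reasoning

    mutual
      size-Bounded : Bounded W h φ → size φ ≤ W ^ h
      size-Bounded {h = h} pos = m^n>0 W h
      size-Bounded {h = h} neg = m^n>0 W h
      size-Bounded (⋀ {h = h} {φs = φs} l β) = size-step h (length φs) (sizeL φs) l (sizeL-Bounded φs β)
      size-Bounded (⋁ {h = h} {φs = φs} l β) = size-step h (length φs) (sizeL φs) l (sizeL-Bounded φs β)

      sizeL-Bounded : (φs : List (Form A)) → (∀ {φ} → φ ∈ φs → Bounded W h φ) →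
                      sizeL φs ≤ length φs * W ^ h
      sizeL-Bounded [] β = z≤n
      sizeL-Bounded (φ ∷ φs) β =
        +-mono-≤ (size-Bounded (β (here refl))) (sizeL-Bounded φs (λ i → β (there i)))

-- A calculus of refutations and its translation into proof lines

-- Refutations of a list of hypotheses, i.e. proofs of the sequent of their duals.  The index h is a
-- rank which stays constant when n grows: an unbounded case distinction and a whole induction along a
-- chain of formulas each count as one step.
data Refutation {A : Set} (W D : ℕ) : ℕ → List (Form A) → Set where
  raise  : ∀ {h k Γ} → h ≤ k → Refutation W D h Γ → Refutation W D k Γ
  clash  : ∀ {h Γ a} → pos a ∈ Γ → neg a ∈ Γ → Refutation W D h Γ
  absurd : ∀ {h Γ} → ⋁ [] ∈ Γ → Refutation W D h Γ
  cases  : ∀ {h Γ φs} → ⋁ φs ∈ Γ → (∀ {φ} → φ ∈ φs → Refutation W D h (φ ∷ Γ)) →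
           Refutation W D (suc h) Γ
  select : ∀ {h Γ φs φ} → ⋀ φs ∈ Γ → φ ∈ φs → Refutation W D h (φ ∷ Γ) → Refutation W D (suc h) Γ
  -- The only rule that becomes cuts, hence the only one that brings in formulas which are not
  -- arguments of hypotheses; so it alone has to demand a bound on depth and width.
  chain  : ∀ {h Γ} (φ : ℕ → Form A) (l : ℕ) → l ≤ W → (∀ i → Bounded W D (φ i)) →
           Refutation W D h (dual (φ 0) ∷ Γ) →
           (∀ i → i < l → Refutation W D h (φ i ∷ dual (φ (suc i)) ∷ Γ)) →
           Refutation W D h (φ l ∷ Γ) →
           Refutation W D (suc h) Γ

Infers-mono : {L L' : List (Seq A)} {S : Seq A} → (∀ {S} → S ∈ L → S ∈ L') → Infers L S → Infers L' S
Infers-mono f (axiom p q) = axiom p q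
Infers-mono f (weak i s) = weak (f i) s
Infers-mono f (and-i is) = and-i (All.map f is)
Infers-mono f (or-i i j) = or-i i (f j)
Infers-mono f (cut i j) = cut (f i) (f j)

Lines-++ : {L L' : List (Seq A)} → Lines L → Lines L' → Lines (L ++ L')
Lines-++ [] v' = v'
Lines-++ {L = _ ∷ L} (i ∷ v) v' = Infers-mono (∈-++⁺ˡ {xs = L}) i ∷ Lines-++ v v'

module Translation {A : Set} (W D C : ℕ) {{_ : NonZero W}} where

  record Derivation (t : ℕ) (S : Seq A) : Set where
    constructor derivation
    field
      ls     : List (Seq A)
      valid  : Lines ls
      member : S ∈ ls
      count  : length ls ≤ t
      short  : All (λ S' → length S' ≤ C × All (Bounded W D) S') ls
  open Derivation

  Good : List (Form A) → Set
  Good Γ = length Γ ≤ C × All (Bounded W D) Γ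

  Good-dualL : {Γ : List (Form A)} → Good Γ → Good (dualL Γ)
  Good-dualL {Γ} (l , β) = subst (_≤ C) (sym (length-dualL Γ)) l , go β
    where
    go : ∀ {Γ} → All (Bounded W D) Γ → All (Bounded W D) (dualL Γ)
    go [] = []
    go (β ∷ bs) = Bounded-dual β ∷ go bs

  more : ∀ {t t' S} → t ≤ t' → Derivation t S → Derivation t' S
  more t≤t' d = record { Derivation d ; count = ≤-trans (count d) t≤t' }

  line : ∀ {t S S'} (d : Derivation t S) → Infers (ls d) S' → Good S' → Derivation (suc t) S'
  line {S' = S'} d i g = derivation (S' ∷ ls d) (i ∷ valid d) (here refl) (s≤s (count d)) (g ∷ short d)

  weaken : ∀ {t S S'} → Derivation t S → (∀ {φ} → φ ∈ S → φ ∈ S') → Good S' → Derivation (suc t) S'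
  weaken d s g = line d (weak (member d) s) g

  record Derivations {I : Set} (t : ℕ) (is : List I) (S : I → Seq A) : Set where
    constructor derivations
    field
      ls      : List (Seq A)
      valid   : Lines ls
      members : All (λ i → S i ∈ ls) is
      count   : length ls ≤ length is * t
      short   : All Good ls

  collect : ∀ {I : Set} {t} (is : List I) (S : I → Seq A) → (∀ {i} → i ∈ is → Derivation t (S i)) →
            Derivations t is S
  collect [] S f = derivations [] [] [] z≤n []
  collect (i ∷ is) S f with f (here refl) | collect is S (λ j → f (there j))
  ... | derivation L v m c s | derivations L' v' m' c' s' =
    derivations (L ++ L') (Lines-++ v v') (∈-++⁺ˡ m ∷ All.map (∈-++⁺ʳ L) m')
      (subst (_≤ _) (sym (length-++ L)) (+-mono-≤ c c')) (All.++⁺ s s')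

  cut-lines : ∀ {t t' S φ} → Derivation t (φ ∷ S) → Derivation t' (dual φ ∷ S) → Good S →
              Derivation (suc (t + t')) S
  cut-lines {S = S} (derivation L v m c s) (derivation L' v' m' c' s') g =
    derivation (S ∷ L ++ L') (cut (∈-++⁺ˡ m) (∈-++⁺ʳ L m') ∷ Lines-++ v v') (here refl)
      (s≤s (subst (_≤ _) (sym (length-++ L)) (+-mono-≤ c c'))) (g ∷ All.++⁺ s s')

  -- The cost of `chain`, the most expensive rule: a link takes the `t` lines of its refutation, a
  -- weakening and a cut, and `1 + (t + l * (2 + t) + t)` is at most `(3 * W + 3) * t`.
  U : ℕ
  U = 3 * W + 3

  instance
    U≢0 : NonZero U
    U≢0 = subst NonZero (+-comm 3 (3 * W)) _

  open ≤-Reasoning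

  2≤U^suc : ∀ h → 2 ≤ U ^ suc h
  2≤U^suc h = begin
    2           ≤⟨ s≤s (s≤s z≤n) ⟩
    3           ≤⟨ m≤n+m 3 (3 * W) ⟩
    U           ≤⟨ m≤m*n U (U ^ h) {{m^n≢0 U h}} ⟩
    U ^ suc h   ∎

  one-step : ∀ {t} w → 1 ≤ t → w ≤ W → suc (suc (w * t)) ≤ U * t
  one-step {t} w 1≤t w≤W = begin
    2 + w * t                                  ≤⟨ +-mono-≤ (*-monoʳ-≤ 2 1≤t) (*-monoˡ-≤ t w≤W) ⟩
    2 * t + W * t                              ≤⟨ m≤m+n _ (2 * W * t + t) ⟩
    2 * t + W * t + (2 * W * t + t)            ≡⟨ solve 2 (λ W t → con 2 :* t :+ W :* t :+ (con 2 :* W :* t :+ t)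
                                                              := (con 3 :* W :+ con 3) :* t) refl W t ⟩
    U * t                                      ∎
    where open +-*-Solver

  one-chain : ∀ {t} l → 1 ≤ t → l ≤ W → suc (t + l * suc (suc t) + t) ≤ U * t
  one-chain {t} l 1≤t l≤W = begin
    1 + (t + l * (2 + t) + t)                  ≤⟨ +-mono-≤ 1≤t (+-monoˡ-≤ t (+-monoʳ-≤ t
                                                    (*-mono-≤ l≤W (+-monoˡ-≤ t (*-monoʳ-≤ 2 1≤t))))) ⟩
    t + (t + W * (2 * t + t) + t)              ≡⟨ solve 2 (λ W t → t :+ (t :+ W :* (con 2 :* t :+ t) :+ t)
                                                              := (con 3 :* W :+ con 3) :* t) refl W t ⟩
    U * t                                      ∎
    where open +-*-Solver

  shift : ∀ l h → l + 2 * suc h ≡ 2 + (l + 2 * h)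
  shift = solve 2 (λ l h → l :+ con 2 :* (con 1 :+ h) := con 2 :+ (l :+ con 2 :* h)) refl
    where open +-*-Solver

  -- Hypotheses are not consumed. A rule puts a second copy of its principal formula in front, and
  -- weakening, which compares sequents as sets, merges the two.
  contract : ∀ {χ ψ : Form A} {S : Seq A} → χ ∈ S → ψ ∈ χ ∷ S → ψ ∈ S
  contract p (here refl) = p
  contract p (there i) = i

  -- A rule that lowers the rank by one adds at most two hypotheses (a link of a chain adds two), so
  -- `length Γ + 2 * h` never grows and all sequents keep to the fixed length `C`.
  translate : ∀ {Γ} → Refutation W D h Γ → All (Bounded W D) Γ → length Γ + 2 * h ≤ C →
              Derivation (U ^ suc h) (dualL Γ)
  translate {k} {Γ} (raise h≤k ρ) bs l =
    more (^-monoʳ-≤ U (s≤s h≤k)) (translate ρ bs (≤-trans (+-monoʳ-≤ (length Γ) (*-monoʳ-≤ 2 h≤k)) l))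
  translate {h} {Γ} (clash p q) bs l =
    more (≤-trans (s≤s z≤n) (2≤U^suc h))
      (derivation (dualL Γ ∷ []) (axiom (∈-dualL⁺ q) (∈-dualL⁺ p) ∷ []) (here refl) (s≤s z≤n)
        (Good-dualL (m+n≤o⇒m≤o _ l , bs) ∷ []))
  translate {h} {Γ} (absurd p) bs l = more (2≤U^suc h)
      -- The dual of the false hypothesis is `⋀ []`, which `and-i` infers from no premises.
      (derivation (dualL Γ ∷ (⋀ [] ∷ []) ∷ []) (weak (here refl) (λ { (here refl) → ∈-dualL⁺ p }) ∷ and-i [] ∷ [])
        (here refl) ≤-refl (Good-dualL (l' , bs) ∷ (≤-trans (nonempty p) l' , (Bounded-dual (All.lookup bs p) ∷ [])) ∷ []))
    where
    l' : length Γ ≤ C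
    l' = m+n≤o⇒m≤o _ l
    nonempty : ∀ {φ} {Γ : List (Form A)} → φ ∈ Γ → 1 ≤ length Γ
    nonempty (here _) = s≤s z≤n
    nonempty (there _) = s≤s z≤n
  translate {suc h} {Γ} (cases {φs = φs} p f) bs l = close (collect φs _ branch)
    where
    room : 2 + (length Γ + 2 * h) ≤ C
    room = subst (_≤ C) (shift (length Γ) h) l
    principal : Bounded W D (⋁ φs)
    principal = All.lookup bs p
    branch : ∀ {φ} → φ ∈ φs → Derivation (U ^ suc h) (dualL (φ ∷ Γ))
    branch i = translate (f i) (⋁-argument principal i ∷ bs) (<⇒≤ room)
    All-dualL : ∀ {P : Form A → Set} {φs} → All (λ φ → P (dual φ)) φs → All P (dualL φs)
    All-dualL [] = []
    All-dualL (p ∷ ps) = p ∷ All-dualL ps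
    close : Derivations (U ^ suc h) φs (λ φ → dualL (φ ∷ Γ)) → Derivation (U ^ suc (suc h)) (dualL Γ)
    close (derivations L v m c s) = more
      (≤-trans (s≤s (s≤s c)) (one-step (length φs) (<⇒≤ (2≤U^suc h)) (<⇒≤ (⋁-width principal))))
      (weaken
        (derivation (dualL (⋁ φs ∷ Γ) ∷ L) (and-i (All-dualL m) ∷ v) (here refl) ≤-refl
          (Good-dualL (m+n≤o⇒m≤o _ (<⇒≤ room) , principal ∷ bs) ∷ s))
        (contract (∈-dualL⁺ p)) (Good-dualL (m+n≤o⇒m≤o _ (≤-trans (n≤1+n _) (<⇒≤ room)) , bs)))
  translate {suc h} {Γ} (select {φs = φs} {φ} p i ρ) bs l = more
    (≤-trans (s≤s (s≤s (≤-reflexive (sym (*-identityˡ _))))) (one-step 1 (<⇒≤ (2≤U^suc h)) (≤-trans (s≤s z≤n) width)))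
    (weaken
      (line d (or-i (∈-dualL⁺ i) (Derivation.member d))
        (Good-dualL (m+n≤o⇒m≤o _ (<⇒≤ room) , principal ∷ bs)))
      (contract (∈-dualL⁺ p)) (Good-dualL (m+n≤o⇒m≤o _ (≤-trans (n≤1+n _) (<⇒≤ room)) , bs)))
    where
    room : 2 + (length Γ + 2 * h) ≤ C
    room = subst (_≤ C) (shift (length Γ) h) l
    principal : Bounded W D (⋀ φs)
    principal = All.lookup bs p
    width : length (dualL φs) < W
    width = ⋁-width (Bounded-dual principal)
    d : Derivation (U ^ suc h) (dualL (φ ∷ Γ))
    d = translate ρ (⋀-argument principal i ∷ bs) (<⇒≤ room)
  translate {suc h} {Γ} (chain φ N N≤W bφ ρ₀ ρ₁ ρ₂) bs l =
    more (one-chain N (<⇒≤ (2≤U^suc h)) N≤W)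
      (cut-lines (reach N ≤-refl) (translate ρ₂ (bφ N ∷ bs) (<⇒≤ room)) (Good-dualL (good₀ , bs)))
    where
    room : 2 + (length Γ + 2 * h) ≤ C
    room = subst (_≤ C) (shift (length Γ) h) l
    good₀ : length Γ ≤ C
    good₀ = m+n≤o⇒m≤o _ (≤-trans (n≤1+n _) (<⇒≤ room))
    t : ℕ
    t = U ^ suc h
    good : ∀ i → Good (φ i ∷ dualL Γ)
    good i = subst (_≤ C) (cong suc (sym (length-dualL Γ))) (m+n≤o⇒m≤o _ (<⇒≤ room)) ,
             bφ i ∷ proj₂ (Good-dualL (good₀ , bs))
    reach : ∀ i → i ≤ N → Derivation (t + i * suc (suc t)) (φ i ∷ dualL Γ)
    reach zero _ = subst (λ ψ → Derivation (t + 0) (ψ ∷ dualL Γ)) (dual-involutive (φ 0))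
      (more (m≤m+n t 0) (translate ρ₀ (Bounded-dual (bφ 0) ∷ bs) (<⇒≤ room)))
    reach (suc i) i<N = more
      (≤-reflexive (solve 2 (λ t n → con 1 :+ (con 1 :+ (t :+ n) :+ t) := t :+ (con 2 :+ t :+ n)) refl t (i * suc (suc t))))
      (cut-lines (weaken (reach i (<⇒≤ i<N)) (λ { (here refl) → here refl ; (there j) → there (there j) })
          (subst (λ l → suc (suc l) ≤ C) (sym (length-dualL Γ)) (m+n≤o⇒m≤o _ room) , bφ i ∷ proj₂ (good (suc i))))
        (subst (λ ψ → Derivation t (dual (φ i) ∷ ψ ∷ dualL Γ)) (dual-involutive (φ (suc i)))
          (translate (ρ₁ i i<N) (bφ i ∷ Bounded-dual (bφ (suc i)) ∷ bs) room))
        (good (suc i)))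
      where open +-*-Solver

  lines-bounds : (L : List (Seq A)) → All Good L →
                 (linesDepth L ≤ D) × (linesSize L ≤ length L * suc (C * W ^ D))
  lines-bounds [] [] = z≤n , z≤n
  lines-bounds (S ∷ L) ((l , β) ∷ s) =
    ⊔-lub (depthL-Bounded S (All.lookup β)) (proj₁ (lines-bounds L s)) ,
    +-mono-≤ (s≤s (≤-trans (sizeL-Bounded S (All.lookup β)) (*-monoˡ-≤ (W ^ D) l))) (proj₂ (lines-bounds L s))

  prove : ∀ {h} {φ : Form A} → Refutation W D h (dual φ ∷ []) → Bounded W D φ → 1 + 2 * h ≤ C →
          Σ (Proof φ) λ π → (proofDepth π ≤ D) × (proofSize π ≤ suc (U ^ suc h) * suc (C * W ^ D))
  prove {h} {φ} ρ β l = result (translate ρ (Bounded-dual β ∷ []) l)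
    where
    result : Derivation (U ^ suc h) (dualL (dual φ ∷ [])) → _
    result (derivation L v m c s) =
      proof L (weak (subst (λ ψ → (ψ ∷ []) ∈ L) (dual-involutive φ) m) id ∷ v) ,
      proj₁ bounds , ≤-trans (proj₂ bounds) (*-monoˡ-≤ (suc (C * W ^ D)) (s≤s c))
      where
      bounds = lines-bounds ([ φ ] ∷ L) ((≤-trans (s≤s z≤n) l , β ∷ []) ∷ s)

-- Quantifiers with decidable side conditions

variable
  W D : ℕ
  P : Set

there² : ∀ {x y z : X} {xs} → x ∈ xs → x ∈ y ∷ z ∷ xs
there² i = there (there i)

there⁴ : ∀ {x y₀ y₁ y₂ y₃ : X} {xs} → x ∈ xs → x ∈ y₀ ∷ y₁ ∷ y₂ ∷ y₃ ∷ xs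
there⁴ i = there² (there² i)

-- An index which violates the side condition keeps its place with a neutral constant, so the width
-- is the length of the index list whatever the condition is.
when : Dec P → Form A → Form A
when (yes _) φ = φ
when (no _) φ = ⋀ []

only : Dec P → Form A → Form A
only (yes _) φ = φ
only (no _) φ = ⋁ []

opaque

  Every Some : (xs : List X) {P : X → Set} → (∀ x → Dec (P x)) → (X → Form A) → Form A
  Every xs P? f = ⋀ (map (λ x → when (P? x) (f x)) xs)
  Some xs P? f = ⋁ (map (λ x → only (P? x) (f x)) xs)

module _ {xs : List X} {P : X → Set} {P? : ∀ x → Dec (P x)} {f : X → Form A} where

  opaque
    unfolding Every Some

    -- Arguments are allotted depth at least 1 even if they are literals, since the neutral constant
    -- `⋀ []` has depth 1.
    Bounded-Every : length xs < W → (∀ {x} → x ∈ xs → Bounded W (suc h) (f x)) → Bounded W (suc (suc h)) (Every xs P? f)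
    Bounded-Every {W} {h} l β = ⋀ (subst (_< W) (sym (length-map _ xs)) l) go
      where
      guarded : ∀ x → Bounded W (suc h) (f x) → Bounded W (suc h) (when (P? x) (f x))
      guarded x β with P? x
      ... | yes _ = β
      ... | no _ = ⋀ (≤-trans (s≤s z≤n) l) (λ ())
      go : φ ∈ map (λ x → when (P? x) (f x)) xs → Bounded W (suc h) φ
      go i with ∈-map⁻ _ i
      ... | x , j , refl = guarded x (β j)

    Bounded-Some : length xs < W → (∀ {x} → x ∈ xs → Bounded W (suc h) (f x)) → Bounded W (suc (suc h)) (Some xs P? f)
    Bounded-Some {W} {h} l β = ⋁ (subst (_< W) (sym (length-map _ xs)) l) go
      where
      guarded : ∀ x → Bounded W (suc h) (f x) → Bounded W (suc h) (only (P? x) (f x))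
      guarded x β with P? x
      ... | yes _ = β
      ... | no _ = ⋁ (≤-trans (s≤s z≤n) l) (λ ())
      go : φ ∈ map (λ x → only (P? x) (f x)) xs → Bounded W (suc h) φ
      go i with ∈-map⁻ _ i
      ... | x , j , refl = guarded x (β j)

    by-Every : Every xs P? f ∈ Γ → ∀ {x} → x ∈ xs → P x →
               Refutation W D h (f x ∷ Γ) → Refutation W D (suc h) Γ
    by-Every {Γ = Γ} {W} {D} {h} p {x} i px ρ = select p (∈-map⁺ _ i) guarded
      where
      guarded : Refutation W D h (when (P? x) (f x) ∷ Γ)
      guarded with P? x
      ... | yes _ = ρ
      ... | no ¬px = ⊥-elim (¬px px)

    by-Some : Some xs P? f ∈ Γ → (∀ {x} → x ∈ xs → P x → Refutation W D h (f x ∷ Γ)) →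
              Refutation W D (suc h) Γ
    by-Some {Γ = Γ} {W} {D} {h} p ρ = cases p go
      where
      guarded : ∀ {x} → x ∈ xs → Refutation W D h (only (P? x) (f x) ∷ Γ)
      guarded {x} i with P? x
      ... | yes px = ρ i px
      ... | no _ = absurd (here refl)
      go : φ ∈ map (λ x → only (P? x) (f x)) xs → Refutation W D h (φ ∷ Γ)
      go i with ∈-map⁻ _ i
      ... | x , j , refl = guarded j

    by-¬Every : dual (Every xs P? f) ∈ Γ → (∀ {x} → x ∈ xs → P x → Refutation W D h (dual (f x) ∷ Γ)) →
                Refutation W D (suc h) Γ
    by-¬Every {Γ = Γ} {W} {D} {h} p ρ = cases p go
      where
      guarded : ∀ {x} → x ∈ xs → Refutation W D h (dual (when (P? x) (f x)) ∷ Γ)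
      guarded {x} i with P? x
      ... | yes px = ρ i px
      ... | no _ = absurd (here refl)
      go : φ ∈ dualL (map (λ x → when (P? x) (f x)) xs) → Refutation W D h (φ ∷ Γ)
      go i with ∈-dualL⁻ _ i
      ... | ψ , j , refl with ∈-map⁻ _ j
      ... | x , j , refl = guarded j

    by-¬Some : dual (Some xs P? f) ∈ Γ → ∀ {x} → x ∈ xs → P x →
               Refutation W D h (dual (f x) ∷ Γ) → Refutation W D (suc h) Γ
    by-¬Some {Γ = Γ} {W} {D} {h} p {x} i px ρ = select p (∈-dualL⁺ (∈-map⁺ _ i)) guarded
      where
      guarded : Refutation W D h (dual (only (P? x) (f x)) ∷ Γ)
      guarded with P? x
      ... | yes _ = ρ
      ... | no ¬px = ⊥-elim (¬px px)

-- Each connective is peeled off by one `cases` and one `select`, hence two units of rank per level.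
contradict : ∀ {V} k → Bounded V k φ → φ ∈ Γ → dual φ ∈ Γ → Refutation W D (2 * k) Γ
contradict k pos p q = clash p q
contradict k neg p q = clash q p
contradict (suc k) (⋀ {φs = φs} _ β) p q = raise (≤-reflexive (sym (*-suc 2 k))) (cases q go)
  where
  go : φ ∈ dualL φs → Refutation _ _ (suc (2 * k)) (φ ∷ _)
  go i with ∈-dualL⁻ φs i
  ... | ψ , j , refl = select (there p) j (contradict k (β j) (here refl) (there (here refl)))
contradict (suc k) (⋁ {φs = φs} _ β) p q = raise (≤-reflexive (sym (*-suc 2 k))) (cases p go)
  where
  go : φ ∈ φs → Refutation _ _ (suc (2 * k)) (φ ∷ _)
  go i = select (there q) (∈-dualL⁺ i) (contradict k (β i) (there (here refl)) (here refl))

-- Edges, columns and regions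

Within : ℕ → Edge → Set
Within m (hor x y) = suc x < m
Within m (ver x y) = x < m

-- e lies in the region x < m and contains the point (m - 1 , y) of its last column.
Touches : ℕ → Edge → ℕ → Set
Touches m (hor x a) y = (suc (suc x) ≡ m) × (a ≡ y)
Touches m (ver x a) y = (suc x ≡ m) × (a ≡ y ⊎ suc a ≡ y)

within? : ∀ m e → Dec (Within m e)
within? m (hor x y) = suc x <? m
within? m (ver x y) = x <? m

touches? : ∀ m e y → Dec (Touches m e y)
touches? m (hor x a) y = (suc (suc x) ≟ m) ×-dec (a ≟ y)
touches? m (ver x a) y = (suc x ≟ m) ×-dec ((a ≟ y) ⊎-dec (suc a ≟ y))

-- The height at which a property is read off an edge on the column. For a vertical edge the other
-- end would do as well unless the property changes along it, and that case is singled out as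
-- `Jump`.
height : Edge → ℕ
height (hor x y) = y
height (ver x y) = y

Within⇒¬Touches : ∀ e {y} → Touches (suc m) e y → ¬ Within m e
Within⇒¬Touches (hor x a) (refl , _) w = <-irrefl refl w
Within⇒¬Touches (ver x a) (refl , _) w = <-irrefl refl w

Within-suc : ∀ e → Within (suc m) e → Within m e ⊎ Touches (suc m) e (height e)
Within-suc {m} (hor x y) (s≤s w) with suc x ≟ m
... | yes refl = inj₂ (refl , refl)
... | no ne = inj₁ (≤∧≢⇒< w ne)
Within-suc {m} (ver x y) (s≤s w) with x ≟ m
... | yes refl = inj₂ (refl , inj₁ refl)
... | no ne = inj₁ (≤∧≢⇒< w ne)

=ᵖ-refl : ∀ p → T (p =ᵖ p)
=ᵖ-refl (x , y) = Equivalence.from Bool.T-∧ (≡⇒≡ᵇ x x refl , ≡⇒≡ᵇ y y refl)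

=ᵖ⇒≡ : ∀ p q → T (p =ᵖ q) → p ≡ q
=ᵖ⇒≡ (x , y) (x' , y') t with Equivalence.to (Bool.T-∧ {x ≡ᵇ x'} {y ≡ᵇ y'}) t
... | t₁ , t₂ = cong₂ _,_ (≡ᵇ⇒≡ x x' t₁) (≡ᵇ⇒≡ y y' t₂)

End : Point → Edge → Set
End p e = p ≡ proj₁ (endpoints e) ⊎ p ≡ proj₂ (endpoints e)

incident⇒End : ∀ p e → T (incident p e) → End p e
incident⇒End p e t with endpoints e
... | u , v with Equivalence.to (Bool.T-∨ {p =ᵖ u} {p =ᵖ v}) t
... | inj₁ t₁ = inj₁ (=ᵖ⇒≡ p u t₁)
... | inj₂ t₂ = inj₂ (=ᵖ⇒≡ p v t₂)

End⇒incident : ∀ p e → End p e → T (incident p e)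
End⇒incident p e t with endpoints e | t
... | u , v | inj₁ refl = Equivalence.from (Bool.T-∨ {p =ᵖ u} {p =ᵖ v}) (inj₁ (=ᵖ-refl p))
... | u , v | inj₂ refl = Equivalence.from (Bool.T-∨ {p =ᵖ u} {p =ᵖ v}) (inj₂ (=ᵖ-refl p))

shareVertex⇒End : ∀ e e' → T (shareVertex e e') → ∃ λ p → End p e × End p e'
shareVertex⇒End e e' t with endpoints e in eq
... | u , v with Equivalence.to (Bool.T-∨ {incident u e'} {incident v e'}) t
... | inj₁ t₁ = u , inj₁ refl , incident⇒End u e' t₁
... | inj₂ t₂ = v , inj₂ refl , incident⇒End v e' t₂

End⇒shareVertex : ∀ e e' p → End p e → End p e' → T (shareVertex e e')
End⇒shareVertex e e' p i i' with endpoints e | i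
... | u , v | inj₁ refl = Equivalence.from (Bool.T-∨ {incident u e'} {incident v e'}) (inj₁ (End⇒incident p e' i'))
... | u , v | inj₂ refl = Equivalence.from (Bool.T-∨ {incident u e'} {incident v e'}) (inj₂ (End⇒incident p e' i'))

shareVertex-sym : ∀ e e' → T (shareVertex e e') → T (shareVertex e' e)
shareVertex-sym e e' t with shareVertex⇒End e e' t
... | p , i , i' = End⇒shareVertex e' e p i' i

Touches⇒End : ∀ e {y} → Touches (suc m) e y → End (m , y) e
Touches⇒End (hor x a) (refl , refl) = inj₂ refl
Touches⇒End (ver x a) (refl , inj₁ refl) = inj₁ refl
Touches⇒End (ver x a) (refl , inj₂ refl) = inj₂ refl

module _ (I : ℕ → Bool) where

  Jump : ℕ → Edge → Set
  Jump m e = ∃ λ a → (e ≡ ver m a) × (I a ≢ I (suc a))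

  height-or-Jump : ∀ e {y} → Touches (suc m) e y → I (height e) ≡ I y ⊎ Jump m e
  height-or-Jump (hor x a) (refl , refl) = inj₁ refl
  height-or-Jump (ver x a) (refl , inj₁ refl) = inj₁ refl
  height-or-Jump (ver x a) (refl , inj₂ refl) with I a Bool.≟ I (suc a)
  ... | yes eq = inj₁ eq
  ... | no ne = inj₂ (a , refl , ne)

  -- The common vertex is either on the column, or it is the left end of two horizontal edges, which
  -- then have the same height.
  adjacent-or-Jump : ∀ e e' {y y'} → Touches (suc m) e y → Touches (suc m) e' y' → T (shareVertex e e') →
                     I (height e) ≡ I (height e') ⊎ (Jump m e ⊎ Jump m e')
  adjacent-or-Jump e e' τ τ' t with shareVertex⇒End e e' t
  ... | p , i , i' = common e e' τ τ' i i'
    where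
    at : ∀ {m e e' z z'} → Touches (suc m) e z → Touches (suc m) e' z' → z ≡ z' →
         I (height e) ≡ I (height e') ⊎ (Jump m e ⊎ Jump m e')
    at {e = e} {e'} τ τ' refl with height-or-Jump e τ | height-or-Jump e' τ'
    ... | inj₁ eq | inj₁ eq' = inj₁ (trans eq (sym eq'))
    ... | inj₂ j | _ = inj₂ (inj₁ j)
    ... | inj₁ _ | inj₂ j = inj₂ (inj₂ j)
    common : ∀ {m p} e e' {y y'} → Touches (suc m) e y → Touches (suc m) e' y' → End p e → End p e' →
         I (height e) ≡ I (height e') ⊎ (Jump m e ⊎ Jump m e')
    common (hor x a) (hor x' a') (refl , _) (refl , _) (inj₁ refl) (inj₁ refl) = inj₁ refl
    common (hor x a) (hor x' a') (refl , _) (refl , _) (inj₂ refl) (inj₂ refl) = inj₁ refl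
    common (hor x a) (ver x' a') (refl , _) (refl , _) (inj₂ refl) (inj₁ refl) = inj₁ refl
    common (hor x a) (ver x' a') (refl , _) (refl , _) (inj₂ refl) (inj₂ refl) =
      at {e = hor x a} {ver x' a'} (refl , refl) (refl , inj₂ refl) refl
    common (ver x a) (hor x' a') (refl , _) (refl , _) (inj₁ refl) (inj₂ refl) = inj₁ refl
    common (ver x a) (hor x' a') (refl , _) (refl , _) (inj₂ refl) (inj₂ refl) =
      at {e = ver x a} {hor x' a'} (refl , inj₂ refl) (refl , refl) refl
    common (ver x a) (ver x' a') (refl , _) (refl , _) (inj₁ refl) (inj₁ refl) = inj₁ refl
    common (ver x a) (ver x' a') (refl , _) (refl , _) (inj₁ refl) (inj₂ refl) =
      at {e = ver x a} {ver x' a'} (refl , inj₁ refl) (refl , inj₂ refl) refl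
    common (ver x a) (ver x' a') (refl , _) (refl , _) (inj₂ refl) (inj₁ refl) =
      at {e = ver x a} {ver x' a'} (refl , inj₂ refl) (refl , inj₁ refl) refl
    common (ver x a) (ver x' a') (refl , _) (refl , _) (inj₂ refl) (inj₂ refl) =
      at {e = ver x a} {ver x' a'} (refl , inj₂ refl) (refl , inj₂ refl) refl

-- An edge of the region x ≤ m meets an edge of the region x < m only through a horizontal edge.
Touches-descend : ∀ e e' {y} → Touches (suc m) e y → Within m e' → T (shareVertex e e') → Touches m e' (height e)
Touches-descend e e' τ w t with shareVertex⇒End e e' t
... | p , i , i' = go e e' τ w i i'
  where
  go : ∀ {m p} e e' {y} → Touches (suc m) e y → Within m e' → End p e → End p e' → Touches m e' (height e)
  go (hor x a) (hor x' a') (refl , _) w (inj₁ refl) (inj₁ refl) = ⊥-elim (<-irrefl refl w)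
  go (hor x a) (hor x' a') (refl , _) w (inj₁ refl) (inj₂ refl) = refl , refl
  go (hor x a) (hor x' a') (refl , _) w (inj₂ refl) (inj₁ refl) = ⊥-elim (<-asym w (n<1+n _))
  go (hor x a) (hor x' a') (refl , _) w (inj₂ refl) (inj₂ refl) = ⊥-elim (<-irrefl refl w)
  go (hor x a) (ver x' a') (refl , _) w (inj₁ refl) (inj₁ refl) = refl , inj₁ refl
  go (hor x a) (ver x' a') (refl , _) w (inj₁ refl) (inj₂ refl) = refl , inj₂ refl
  go (hor x a) (ver x' a') (refl , _) w (inj₂ refl) (inj₁ refl) = ⊥-elim (<-irrefl refl w)
  go (hor x a) (ver x' a') (refl , _) w (inj₂ refl) (inj₂ refl) = ⊥-elim (<-irrefl refl w)
  go (ver x a) (hor x' a') (refl , _) w (inj₁ refl) (inj₁ refl) = ⊥-elim (<-asym w (n<1+n _))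
  go (ver x a) (hor x' a') (refl , _) w (inj₁ refl) (inj₂ refl) = ⊥-elim (<-irrefl refl w)
  go (ver x a) (hor x' a') (refl , _) w (inj₂ refl) (inj₁ refl) = ⊥-elim (<-asym w (n<1+n _))
  go (ver x a) (hor x' a') (refl , _) w (inj₂ refl) (inj₂ refl) = ⊥-elim (<-irrefl refl w)
  go (ver x a) (ver x' a') (refl , _) w (inj₁ refl) (inj₁ refl) = ⊥-elim (<-irrefl refl w)
  go (ver x a) (ver x' a') (refl , _) w (inj₁ refl) (inj₂ refl) = ⊥-elim (<-irrefl refl w)
  go (ver x a) (ver x' a') (refl , _) w (inj₂ refl) (inj₁ refl) = ⊥-elim (<-irrefl refl w)
  go (ver x a) (ver x' a') (refl , _) w (inj₂ refl) (inj₂ refl) = ⊥-elim (<-irrefl refl w)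

-- Walks, and properties preserved along them

-- A walk described by formulas: at k s says that the k-th edge is edge s.
record Walk {A : Set} (W L : ℕ) (G : List (Form A)) : Set₁ where
  field
    State      : Set
    states     : List State
    edge       : State → Edge
    at         : ℕ → State → Form A
    at-bounded : ∀ k s → Bounded W 1 (at k s)
    rows       : ℕ
    below      : ∀ {s m y} → s ∈ states → Touches m (edge s) y → y < rows
    few-times  : L < W
    few-states : length states < W
    few-pairs  : length (cartesianProduct (upTo L) states) < W

  Occurs : List (Form A) → ℕ → State → Set
  Occurs Γ k s = (k < L) × (s ∈ states) × (at k s ∈ Γ)

  -- Only consistency is demanded of a walk. That some edge occurs at each time of an interval is
  -- part of `Remains`, so a walk may stop at any time.
  field
    step   : ∀ {Γ k s s'} → G ⊆ Γ → Occurs Γ k s → Occurs Γ (suc k) s' →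
             ¬ T (shareVertex (edge s) (edge s')) → Refutation W 5 6 Γ
    unique : ∀ {Γ k s s'} → G ⊆ Γ → Occurs Γ k s → Occurs Γ k s' → edge s ≢ edge s' → Refutation W 5 6 Γ

  Occurs-⊆ : ∀ {Γ Δ k s} → Γ ⊆ Δ → Occurs Γ k s → Occurs Δ k s
  Occurs-⊆ g (k<L , i , p) = k<L , i , g p

  Inside : ℕ → ℕ → Form A
  Inside m k = Some states (λ s → within? m (edge s)) (at k)

  Remains : ℕ → ℕ → ℕ → Form A
  Remains m k k' = Every (upTo L) (λ j → (k ≤? j) ×-dec (j ≤? k')) (Inside m)

  times<W : length (upTo L) < W
  times<W = subst (_< W) (sym (length-upTo L)) few-times

  Inside-bounded : ∀ m k → Bounded W 2 (Inside m k)
  Inside-bounded m k = Bounded-Some few-states (λ _ → at-bounded k _)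

  Remains-bounded : ∀ m k k' → Bounded W 3 (Remains m k k')
  Remains-bounded m k k' = Bounded-Every times<W (λ _ → Inside-bounded m _)

  -- The times, states and heights of the two ends of a subwalk. What happens in between enters only
  -- through `Remains`, so the chords are polynomially many although the subwalks need not be.
  Chord : Set
  Chord = (ℕ × ℕ) × (State × State) × (ℕ × ℕ)

  chords : List Chord
  chords = cartesianProduct (cartesianProduct (upTo L) (upTo L))
             (cartesianProduct (cartesianProduct states states) (cartesianProduct (upTo rows) (upTo rows)))

  Joins : ℕ → Chord → Set
  Joins m ((k , k') , (s , s') , (y , y')) = (k ≤ k') × Touches m (edge s) y × Touches m (edge s') y'

  joins? : ∀ m c → Dec (Joins m c)
  joins? m ((k , k') , (s , s') , (y , y')) =
    (k ≤? k') ×-dec (touches? m (edge s) y ×-dec touches? m (edge s') y')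

  excursion : ℕ → Chord → List (Form A)
  excursion m ((k , k') , (s , s') , _) = at k s ∷ at k' s' ∷ Remains m k k' ∷ []

  ∈-chords⁺ : ∀ {Γ m k k' s s' y y'} → Occurs Γ k s → Occurs Γ k' s' → Joins m ((k , k') , (s , s') , (y , y')) →
              ((k , k') , (s , s') , (y , y')) ∈ chords
  ∈-chords⁺ (k<L , i , _) (k'<L , i' , _) (_ , τ , τ') =
    ∈-cartesianProduct⁺ (∈-cartesianProduct⁺ (∈-upTo⁺ k<L) (∈-upTo⁺ k'<L))
      (∈-cartesianProduct⁺ (∈-cartesianProduct⁺ i i') (∈-cartesianProduct⁺ (∈-upTo⁺ (below i τ)) (∈-upTo⁺ (below i' τ'))))

  ∈-chords⁻ : ∀ {k k' s s' y y'} → ((k , k') , (s , s') , (y , y')) ∈ chords →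
              (k < L × k' < L) × (s ∈ states × s' ∈ states)
  ∈-chords⁻ i with ∈-cartesianProduct⁻ _ _ i
  ... | i₁ , i₂ with ∈-cartesianProduct⁻ (upTo L) (upTo L) i₁ | ∈-cartesianProduct⁻ (cartesianProduct states states) _ i₂
  ... | j₁ , j₂ | j₃ , _ = (∈-upTo⁻ j₁ , ∈-upTo⁻ j₂) , ∈-cartesianProduct⁻ states states j₃

  -- A walk in the region x ≤ m is composed of edges on the column x = m and of excursions to the region
  -- x < m.  A property I of heights which is preserved by all of them is preserved by the walk.
  module _ {Γ : List (Form A)} (g : G ⊆ Γ) (m : ℕ) (I : ℕ → Bool)
    (no-Jump : ∀ {Δ k s} → Γ ⊆ Δ → Occurs Δ k s → Jump I m (edge s) → Refutation W 5 h Δ)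
    -- The edges of `s₀` and `s₁`, from which the excursion departs and to which it returns, contain
    -- the points of the column x = m at the heights `y` and `y'`; the other walk is thereby kept
    -- away from these points.
    (no-jumping-excursion : ∀ {Δ k k' s s' k₀ s₀ k₁ s₁ y y'} → Γ ⊆ Δ → Joins m ((k , k') , (s , s') , (y , y')) →
       Occurs Δ k s → Occurs Δ k' s' → Remains m k k' ∈ Δ →
       Occurs Δ k₀ s₀ → Touches (suc m) (edge s₀) y → Occurs Δ k₁ s₁ → Touches (suc m) (edge s₁) y' →
       I y ≢ I y' → Refutation W 5 h Δ)
    where

    Marked : Bool → State → Set
    Marked v s = Touches (suc m) (edge s) (height (edge s)) × (I (height (edge s)) ≡ v)

    marked? : ∀ v s → Dec (Marked v s)
    marked? v s = touches? (suc m) (edge s) (height (edge s)) ×-dec (I (height (edge s)) Bool.≟ v)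

    -- The last visit to the column x = m up to time k was at a height with I = v.
    LastVisit : Bool → ℕ → Form A
    LastVisit v k = Some (cartesianProduct (upTo L) states) (λ (j , s) → (j ≤? k) ×-dec marked? v s)
                      (λ (j , s) → ⋀ (at j s ∷ Remains m (suc j) k ∷ []))

    -- `Remains` is given depth 3, and the conjunction and the disjunction add 2. This and
    -- `Unlinked` account for the depth 5 of the cut formulas.
    LastVisit-bounded : 2 < W → ∀ v k → Bounded W 5 (LastVisit v k)
    LastVisit-bounded 2<W v k = Bounded-Some few-pairs
      (λ _ → ⋀ 2<W λ { (here refl) → Bounded-mono (s≤s z≤n) (at-bounded _ _)
                     ; (there (here refl)) → Remains-bounded m _ _
                     ; (there (there ())) })

    witness : ∀ {Δ v k j s r} → dual (LastVisit v k) ∈ Δ → Occurs Δ j s → j ≤ k → Marked v s →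
              (∀ {Δ' i} → Δ ⊆ Δ' → i < L → suc j ≤ i → i ≤ k → dual (Inside m i) ∈ Δ' → Refutation W 5 (suc r) Δ') →
              Refutation W 5 (4 + r) Δ
    witness p (j<L , i , q) j≤k μ f =
      by-¬Some p (∈-cartesianProduct⁺ (∈-upTo⁺ j<L) i) (j≤k , μ) (cases (here refl) λ
        { (here refl) → raise (s≤s (s≤s z≤n)) (contradict 1 (at-bounded _ _) (there (there q)) (here refl))
        ; (there (here refl)) → by-¬Every (here refl) λ l (lo , hi) →
            f (λ i → there (there (there i))) (∈-upTo⁻ l) lo hi (here refl) })

    -- At time `suc k` the walk is either inside x < m, which prolongs the stay since the last
    -- visit, or on the column. If it is there with the wrong value, then either an excursion has
    -- just ended (`j < k`) or two consecutive edges lie on the column (`j = k`), and one of the two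
    -- assumed refutations applies.
    advance : ∀ {Δ v k₀ k k'} → Γ ⊆ Δ → k₀ ≤ suc k → k < k' → k' < L → Remains (suc m) k₀ k' ∈ Δ →
              LastVisit v k ∈ Δ → dual (LastVisit v (suc k)) ∈ Δ → Refutation W 5 (18 + h) Δ
    advance {Δ} {v} {k = k} {k'} γ k₀≤k k<k' k'<L reg p q =
      by-Every reg (∈-upTo⁺ (<-≤-trans (s≤s k<k') k'<L)) (k₀≤k , k<k')
      (by-Some (here refl) λ {s₂} i₂ w₂ →
       by-Some (there² p) λ {(j , s₀)} ij (j≤k , μ) →
       select (here refl) (here refl) (select (there (here refl)) (there (here refl))
       (moved i₂ w₂ ij j≤k μ)))
      where
      context : State → ℕ → State → List (Form A)
      context s₂ j s₀ = Remains m (suc j) k ∷ at j s₀ ∷ ⋀ (at j s₀ ∷ Remains m (suc j) k ∷ []) ∷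
                        at (suc k) s₂ ∷ Inside (suc m) (suc k) ∷ Δ
      moved : ∀ {s₂ j s₀} → s₂ ∈ states → Within (suc m) (edge s₂) → (j , s₀) ∈ cartesianProduct (upTo L) states →
              j ≤ k → Marked v s₀ → Refutation W 5 (13 + h) (context s₂ j s₀)
      moved {s₂} {j} {s₀} i₂ w₂ ij j≤k (τ₀ , μ₀) = by-location (Within-suc (edge s₂) w₂)
        where
        1+k<L : suc k < L
        1+k<L = <-≤-trans (s≤s k<k') k'<L
        k<L : k < L
        k<L = <-trans (n<1+n k) 1+k<L
        o₀ : Occurs (context s₂ j s₀) j s₀
        o₀ with ∈-cartesianProduct⁻ (upTo L) states ij
        ... | j∈ , i₀ = ∈-upTo⁻ j∈ , i₀ , there (here refl)
        o₂ : Occurs (context s₂ j s₀) (suc k) s₂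
        o₂ = 1+k<L , i₂ , there² (there (here refl))
        base : Γ ⊆ context s₂ j s₀
        base i = there⁴ (there (γ i))
        by-step : ∀ {Δ' i t t'} → context s₂ j s₀ ⊆ Δ' → Occurs Δ' i t → Occurs Δ' (suc i) t' →
                  (T (shareVertex (edge t) (edge t')) → Refutation W 5 (9 + h) Δ') → Refutation W 5 (9 + h) Δ'
        by-step {t = t} {t'} δ o o' f with Bool.T? (shareVertex (edge t) (edge t'))
        ... | yes t = f t
        ... | no ¬t = raise (m≤m+n 6 (3 + h)) (step (λ i → δ (base (g i))) o o' ¬t)
        by-location : Within m (edge s₂) ⊎ Touches (suc m) (edge s₂) (height (edge s₂)) →
                      Refutation W 5 (13 + h) (context s₂ j s₀)
        by-location (inj₁ w) = raise (m≤m+n 8 (5 + h)) (witness (there⁴ (there q)) o₀ (≤-trans j≤k (n≤1+n k)) (τ₀ , μ₀) still-inside)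
          where
          still-inside : ∀ {Δ' i} → context s₂ j s₀ ⊆ Δ' → i < L → suc j ≤ i → i ≤ suc k → dual (Inside m i) ∈ Δ' →
                         Refutation W 5 5 Δ'
          still-inside δ i<L lo hi p with m≤n⇒m<n∨m≡n hi
          ... | inj₁ i≤k = by-Every (δ (here refl)) (∈-upTo⁺ i<L) (lo , ≤-pred i≤k)
                             (contradict 2 (Inside-bounded m _) (here refl) (there p))
          ... | inj₂ refl = raise (m≤m+n 3 2) (by-¬Some p i₂ w
                              (contradict 1 (at-bounded _ _) (there (δ (proj₂ (proj₂ o₂)))) (here refl)))
        by-location (inj₂ τ₂) with I (height (edge s₂)) Bool.≟ v
        ... | yes μ₂ = raise (m≤m+n 4 (9 + h)) (witness {r = 0} (there⁴ (there q)) o₂ ≤-refl (τ₂ , μ₂)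
                         λ _ _ lo hi _ → ⊥-elim (<-irrefl refl (≤-trans lo hi)))
        ... | no μ₂ with m≤n⇒m<n∨m≡n j≤k
        ... | inj₁ j<k =
          by-Every (here refl) (∈-upTo⁺ (≤-<-trans j<k k<L)) (≤-refl , j<k)
          (by-Some (here refl) λ {s₁} i₁ w₁ →
           by-Every (there² (here refl)) (∈-upTo⁺ k<L) (j<k , ≤-refl)
          (by-Some (here refl) λ {s₃} i₃ w₃ →
           by-step there⁴ (Occurs-⊆ there⁴ o₀) (≤-<-trans j<k k<L , i₁ , there² (here refl)) λ t₀₁ →
           by-step there⁴ (k<L , i₃ , here refl) (Occurs-⊆ there⁴ o₂) λ t₃₂ →
           raise (m≤n+m h 9)
             (no-jumping-excursion (λ i → there⁴ (base i))
               (j<k , Touches-descend (edge s₀) (edge s₁) τ₀ w₁ t₀₁ ,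
                Touches-descend (edge s₂) (edge s₃) τ₂ w₃ (shareVertex-sym (edge s₃) (edge s₂) t₃₂))
               (≤-<-trans j<k k<L , i₁ , there² (here refl)) (k<L , i₃ , here refl) (there⁴ (here refl))
               (Occurs-⊆ there⁴ o₀) τ₀ (Occurs-⊆ there⁴ o₂) τ₂ (λ eq → μ₂ (trans (sym eq) μ₀)))))
        ... | inj₂ refl = raise (m≤n+m (9 + h) 4) (by-step id o₀ o₂ λ t →
                            raise (m≤n+m h 9) (by-adjacency (adjacent-or-Jump I (edge s₀) (edge s₂) τ₀ τ₂ t)))
          where
          by-adjacency : I (height (edge s₀)) ≡ I (height (edge s₂)) ⊎ (Jump I m (edge s₀) ⊎ Jump I m (edge s₂)) →
                         Refutation W 5 h (context s₂ j s₀)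
          by-adjacency (inj₁ eq) = ⊥-elim (μ₂ (trans (sym eq) μ₀))
          by-adjacency (inj₂ (inj₁ jump)) = no-Jump base o₀ jump
          by-adjacency (inj₂ (inj₂ jump)) = no-Jump base o₂ jump

    -- `LastVisit v` is carried from time `k` to time `k'`. There the edge of `s'` is on the column,
    -- so by uniqueness the last visit is at `k'` itself and by this very edge, whose value differs
    -- from `v`.
    preserved : 2 < W → ∀ {k k' s s' y y'} → Joins (suc m) ((k , k') , (s , s') , (y , y')) → I y ≢ I y' →
                Occurs Γ k s → Occurs Γ k' s' → Remains (suc m) k k' ∈ Γ → Refutation W 5 (19 + h) Γ
    preserved 2<W {k} {k'} {s} {s'} (k≤k' , τ , τ') ne o o' reg
      with height-or-Jump I (edge s) τ | height-or-Jump I (edge s') τ'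
    ... | inj₂ jump | _ = raise (m≤n+m h 19) (no-Jump id o jump)
    ... | inj₁ _ | inj₂ jump = raise (m≤n+m h 19) (no-Jump id o' jump)
    ... | inj₁ eq | inj₁ eq' =
      chain (λ i → LastVisit v (k + i)) (k' ∸ k)
        (≤-trans (m∸n≤m k' k) (<⇒≤ (<-trans (proj₁ o') few-times)))
        (λ i → LastVisit-bounded 2<W v (k + i))
        (raise (m≤m+n 4 (14 + h)) (witness {r = 0} (here refl) (Occurs-⊆ there o) (m≤m+n k 0) (mark (edge s) τ , refl)
          λ _ _ lo hi _ → ⊥-elim (<-irrefl refl (≤-trans lo (subst (_ ≤_) (+-identityʳ k) hi)))))
        (λ i i<l → subst (λ k₂ → Refutation W 5 (18 + h) (LastVisit v (k + i) ∷ dual (LastVisit v k₂) ∷ Γ)) (sym (+-suc k i))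
          (advance there² (≤-trans (m≤m+n k i) (n≤1+n _))
            (subst (k + i <_) (m+[n∸m]≡n k≤k') (+-monoʳ-< k i<l)) (proj₁ o') (there² reg) (here refl) (there (here refl))))
        (subst (λ k₂ → Refutation W 5 (18 + h) (LastVisit v k₂ ∷ Γ)) (sym (m+[n∸m]≡n k≤k'))
          (by-Some (here refl) λ {(j , s₀)} ij (j≤k' , μ) →
           select (here refl) (here refl) (select (there (here refl)) (there (here refl)) (arrived ij j≤k' μ))))
      where
      v : Bool
      v = I (height (edge s))
      mark : ∀ e {y} → Touches (suc m) e y → Touches (suc m) e (height e)
      mark (hor x a) (eq , _) = eq , refl
      mark (ver x a) (eq , _) = eq , inj₁ refl
      arrived : ∀ {j s₀} → (j , s₀) ∈ cartesianProduct (upTo L) states → j ≤ k' → Marked v s₀ →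
                Refutation W 5 (15 + h) (Remains m (suc j) k' ∷ at j s₀ ∷ ⋀ (at j s₀ ∷ Remains m (suc j) k' ∷ []) ∷ LastVisit v k' ∷ Γ)
      arrived {j} {s₀} ij j≤k' (_ , μ) with m≤n⇒m<n∨m≡n j≤k'
      ... | inj₁ j<k' = by-Every (here refl) (∈-upTo⁺ (proj₁ o')) (j<k' , ≤-refl)
        (by-Some (here refl) λ i₁ w₁ → raise (m≤m+n 6 (7 + h))
          (unique (λ i → there² (there⁴ (g i))) (Occurs-⊆ (there² ∘ there⁴) o') (proj₁ o' , i₁ , here refl)
            λ eq₁ → Within⇒¬Touches (edge s') τ' (subst (Within m) (sym eq₁) w₁)))
      ... | inj₂ refl = raise (m≤m+n 6 (9 + h))
        (unique (λ i → there⁴ (g i)) (Occurs-⊆ there⁴ o')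
          (proj₁ o' , proj₂ (∈-cartesianProduct⁻ (upTo L) states ij) , there (here refl))
          λ eq₁ → ne (trans (sym eq) (trans (sym μ) (trans (cong (I ∘ height) (sym eq₁)) eq'))))

-- Interleaving as the parity of four comparisons

-- The number modulo 2 of pairs (p , q) with p ∈ {a , a'}, q ∈ {c , d} and q < p is the parity of
-- side c d a + side c d a' and also of side′ a a' c + side′ a a' d; it is odd if {a , a'} and {c , d} interleave.
side side′ : ℕ → ℕ → ℕ → Bool
side c d a = (c <ᵇ a) xor (d <ᵇ a)
side′ a a' c = (c <ᵇ a) xor (c <ᵇ a')

Interleave : ℕ × ℕ → ℕ × ℕ → Set
Interleave (a , a') (c , d) = side c d a ≢ side c d a'

interleave? : ∀ p q → Dec (Interleave p q)
interleave? (a , a') (c , d) with side c d a Bool.≟ side c d a'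
... | yes eq = no λ ne → ne eq
... | no ne = yes ne

-- Both equations say that the four bits have an even sum.
xor-swap : ∀ p q r s → p xor r ≡ q xor s → p xor q ≡ r xor s
xor-swap false false false false _ = refl
xor-swap false false true true _ = refl
xor-swap false true false true _ = refl
xor-swap false true true false _ = refl
xor-swap true false false true _ = refl
xor-swap true false true false _ = refl
xor-swap true true false false _ = refl
xor-swap true true true true _ = refl

side-swap : ∀ a a' c d → side c d a ≡ side c d a' → side′ a a' c ≡ side′ a a' d
side-swap a a' c d = xor-swap (c <ᵇ a) (c <ᵇ a') (d <ᵇ a) (d <ᵇ a')

side′-swap : ∀ a a' c d → side′ a a' c ≡ side′ a a' d → side c d a ≡ side c d a'
side′-swap a a' c d = xor-swap (c <ᵇ a) (d <ᵇ a) (c <ᵇ a') (d <ᵇ a')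

<ᵇ-sucʳ : ∀ c a → (c <ᵇ a) ≡ (c <ᵇ suc a) ⊎ c ≡ a
<ᵇ-sucʳ zero zero = inj₂ refl
<ᵇ-sucʳ zero (suc a) = inj₁ refl
<ᵇ-sucʳ (suc c) zero = inj₁ refl
<ᵇ-sucʳ (suc c) (suc a) with <ᵇ-sucʳ c a
... | inj₁ eq = inj₁ eq
... | inj₂ refl = inj₂ refl

<ᵇ-sucˡ : ∀ c a → (c <ᵇ a) ≡ (suc c <ᵇ a) ⊎ suc c ≡ a
<ᵇ-sucˡ c zero = inj₁ refl
<ᵇ-sucˡ c (suc a) with <ᵇ-sucʳ c a
... | inj₁ eq = inj₁ (sym eq)
... | inj₂ refl = inj₂ refl

-- Since the comparisons are strict, `side` changes when the lower end of a vertical edge is at `c`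
-- or `d`, whereas `side′` changes when the upper end is at `a` or `a'`. Hence blue edges will meet
-- the other walk in their lower and red ones in their upper end.
side-jump : ∀ c d a → side c d a ≢ side c d (suc a) → c ≡ a ⊎ d ≡ a
side-jump c d a ne with <ᵇ-sucʳ c a | <ᵇ-sucʳ d a
... | inj₂ eq | _ = inj₁ eq
... | inj₁ _ | inj₂ eq = inj₂ eq
... | inj₁ eq | inj₁ eq' = ⊥-elim (ne (cong₂ _xor_ eq eq'))

side′-jump : ∀ a a' c → side′ a a' c ≢ side′ a a' (suc c) → suc c ≡ a ⊎ suc c ≡ a'
side′-jump a a' c ne with <ᵇ-sucˡ c a | <ᵇ-sucˡ c a'
... | inj₂ eq | _ = inj₁ eq
... | inj₁ _ | inj₂ eq = inj₂ eq
... | inj₁ eq | inj₁ eq' = ⊥-elim (ne (cong₂ _xor_ eq eq'))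

-- Induction over the columns

module Crossing {A : Set} {W L : ℕ} {G : List (Form A)} (B R : Walk W L G)
  (disjoint : ∀ {Γ k s l t p} → G ⊆ Γ → Walk.Occurs B Γ k s → Walk.Occurs R Γ l t →
              End p (Walk.edge B s) → End p (Walk.edge R t) → Refutation W 5 6 Γ)
  (few-chords : length (cartesianProduct (Walk.chords B) (Walk.chords R)) < W)
  (6<W : 6 < W)
  where

  private
    module B = Walk B
    module R = Walk R

  both : ℕ → B.Chord × R.Chord → List (Form A)
  both m (c , c') = B.excursion m c ++ R.excursion m c'

  Linked : ℕ → B.Chord × R.Chord → Set
  Linked m (c , c') = B.Joins m c × R.Joins m c' × Interleave (proj₂ (proj₂ c)) (proj₂ (proj₂ c'))

  linked? : ∀ m cc → Dec (Linked m cc)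
  linked? m (c , c') = B.joins? m c ×-dec (R.joins? m c' ×-dec interleave? (proj₂ (proj₂ c)) (proj₂ (proj₂ c')))

  -- In the region x < m, subwalks of the two walks with ends on its last column do not have interleaving ends.
  Unlinked : ℕ → Form A
  Unlinked m = Every (cartesianProduct B.chords R.chords) (linked? m) (λ cc → dual (⋀ (both m cc)))

  Unlinked-bounded : ∀ m → Bounded W 5 (Unlinked m)
  Unlinked-bounded m = Bounded-Every few-chords λ _ → Bounded-dual (⋀ 6<W λ
    { (here refl) → Bounded-mono (s≤s z≤n) (B.at-bounded _ _)
    ; (there (here refl)) → Bounded-mono (s≤s z≤n) (B.at-bounded _ _)
    ; (there (there (here refl))) → B.Remains-bounded _ _ _
    ; (there (there (there (here refl)))) → Bounded-mono (s≤s z≤n) (R.at-bounded _ _)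
    ; (there (there (there (there (here refl))))) → Bounded-mono (s≤s z≤n) (R.at-bounded _ _)
    ; (there (there (there (there (there (here refl)))))) → R.Remains-bounded _ _ _
    ; (there (there (there (there (there (there ())))))) })

  apply-Unlinked : ∀ {Γ m k k' s s' y y' l l' t t' z z'} → Unlinked m ∈ Γ →
    B.Joins m ((k , k') , (s , s') , (y , y')) → R.Joins m ((l , l') , (t , t') , (z , z')) →
    Interleave (y , y') (z , z') →
    B.Occurs Γ k s → B.Occurs Γ k' s' → B.Remains m k k' ∈ Γ →
    R.Occurs Γ l t → R.Occurs Γ l' t' → R.Remains m l l' ∈ Γ → Refutation W 5 8 Γ
  apply-Unlinked {k = k} {k'} {s} {s'} {y} {y'} {l} {l'} {t} {t'} {z} {z'} p J J' x o₁ o₂ p₃ o₄ o₅ p₆ =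
    by-Every p {x = ((k , k') , (s , s') , (y , y')) , ((l , l') , (t , t') , (z , z'))}
      (∈-cartesianProduct⁺ (B.∈-chords⁺ o₁ o₂ J) (R.∈-chords⁺ o₄ o₅ J')) (J , J' , x)
    (cases (here refl) λ
      { (here refl) → by-occurrence (contradict 1 (B.at-bounded _ _) (there² (proj₂ (proj₂ o₁))) (here refl))
      ; (there (here refl)) → by-occurrence (contradict 1 (B.at-bounded _ _) (there² (proj₂ (proj₂ o₂))) (here refl))
      ; (there (there (here refl))) → contradict 3 (B.Remains-bounded _ _ _) (there² p₃) (here refl)
      ; (there (there (there (here refl)))) → by-occurrence (contradict 1 (R.at-bounded _ _) (there² (proj₂ (proj₂ o₄))) (here refl))
      ; (there (there (there (there (here refl))))) → by-occurrence (contradict 1 (R.at-bounded _ _) (there² (proj₂ (proj₂ o₅))) (here refl))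
      ; (there (there (there (there (there (here refl)))))) → contradict 3 (R.Remains-bounded _ _ _) (there² p₆) (here refl)
      ; (there (there (there (there (there (there ())))))) })
    where
    by-occurrence : ∀ {Γ} → Refutation W 5 2 Γ → Refutation W 5 6 Γ
    by-occurrence = raise (m≤m+n 2 4)

  -- The red subwalk would have to change `side′ y y'`. A vertical edge which does so meets an end
  -- of the blue subwalk. If an excursion with ends at `c` and `d` does so, the blue subwalk changes
  -- `side c d`: by an edge, which meets one of the red edges next to the excursion, or by an
  -- excursion, which `Unlinked m` excludes. The ranks are 8 for `apply-Unlinked`, 19 for each
  -- `preserved`, 6 for the selections and 1 for the case distinction, that is 53.
  Unlinked-step : ∀ {Γ m} → G ⊆ Γ → Unlinked m ∈ Γ → dual (Unlinked (suc m)) ∈ Γ → Refutation W 5 60 Γ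
  Unlinked-step {Γ} {m} g p q = raise (m≤m+n 53 7)
    (by-¬Every q λ {cc} i linked → go cc i linked (subst (_∈ dual (dual (⋀ (both (suc m) cc))) ∷ Γ)
      (dual-involutive (⋀ (both (suc m) cc))) (here refl)))
    where
    go : ∀ cc → cc ∈ cartesianProduct B.chords R.chords → Linked (suc m) cc →
         ⋀ (both (suc m) cc) ∈ dual (dual (⋀ (both (suc m) cc))) ∷ Γ →
         Refutation W 5 52 (dual (dual (⋀ (both (suc m) cc))) ∷ Γ)
    go (((k , k') , (s , s') , (y , y')) , ((l , l') , (t , t') , (z , z'))) i (J , J' , x) χ
      with ∈-cartesianProduct⁻ B.chords R.chords i
    ... | i₁ , i₂ with B.∈-chords⁻ i₁ | R.∈-chords⁻ i₂
    ... | (k<L , k'<L) , (s∈ , s'∈) | (l<L , l'<L) , (t∈ , t'∈) =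
      select χ (here refl) (select (there χ) (there (here refl)) (select (there² χ) (there (there (here refl)))
      (select (there (there² χ)) (there (there (there (here refl))))
      (select (there⁴ χ) (there (there (there (there (here refl)))))
      (select (there (there⁴ χ)) (there (there (there (there (there (here refl))))))
      (R.preserved weaken m (side′ y y') (λ {_} {_} {t} → no-Jump {t = t}) no-jumping-excursion (<-trans (m≤m+n 3 3) 6<W) J'
        (λ eq → x (side′-swap y y' z z' eq))
        (l<L , t∈ , there² (here refl)) (l'<L , t'∈ , there (here refl)) (here refl)))))))
      where
      Γ₁ : List (Form A)
      Γ₁ = R.Remains (suc m) l l' ∷ R.at l' t' ∷ R.at l t ∷ B.Remains (suc m) k k' ∷ B.at k' s' ∷ B.at k s ∷
           dual (dual (⋀ (both (suc m) (((k , k') , (s , s') , (y , y')) , ((l , l') , (t , t') , (z , z')))))) ∷ Γ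
      weaken : G ⊆ Γ₁
      weaken i = there (there² (there⁴ (g i)))
      o : B.Occurs Γ₁ k s
      o = k<L , s∈ , there (there⁴ (here refl))
      o' : B.Occurs Γ₁ k' s'
      o' = k'<L , s'∈ , there⁴ (here refl)
      no-Jump : ∀ {Δ j t} → Γ₁ ⊆ Δ → R.Occurs Δ j t → Jump (side′ y y') m (R.edge t) → Refutation W 5 27 Δ
      no-Jump {Δ} {j} {t} δ oₜ (a , eq , ne) = raise (m≤m+n 6 21) (meets (side′-jump y y' a ne))
        where
        end : End (m , suc a) (R.edge t)
        end = subst (End (m , suc a)) (sym eq) (inj₂ refl)
        meets : suc a ≡ y ⊎ suc a ≡ y' → Refutation W 5 6 Δ
        meets (inj₁ refl) = disjoint (δ ∘ weaken) (B.Occurs-⊆ δ o) oₜ (Touches⇒End (B.edge s) (proj₁ (proj₂ J))) end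
        meets (inj₂ refl) = disjoint (δ ∘ weaken) (B.Occurs-⊆ δ o') oₜ (Touches⇒End (B.edge s') (proj₂ (proj₂ J))) end
      no-jumping-excursion : ∀ {Δ j j' u u' j₀ u₀ j₁ u₁ c d} → Γ₁ ⊆ Δ → R.Joins m ((j , j') , (u , u') , (c , d)) →
        R.Occurs Δ j u → R.Occurs Δ j' u' → R.Remains m j j' ∈ Δ →
        R.Occurs Δ j₀ u₀ → Touches (suc m) (R.edge u₀) c → R.Occurs Δ j₁ u₁ → Touches (suc m) (R.edge u₁) d →
        side′ y y' c ≢ side′ y y' d → Refutation W 5 27 Δ
      no-jumping-excursion {Δ} {u₀ = u₀} {u₁ = u₁} {c = c} {d} δ K oᵤ oᵤ' reg o₀ τ₀ o₁ τ₁ ne =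
        B.preserved (δ ∘ weaken) m (side c d) (λ {_} {_} {v} → no-Jumpᴮ {v = v})
          (λ ε K' oᵥ oᵥ' reg' _ _ _ _ ne' →
            apply-Unlinked (ε (δ (there (there² (there⁴ p))))) K' K ne' oᵥ oᵥ' reg'
              (R.Occurs-⊆ ε oᵤ) (R.Occurs-⊆ ε oᵤ') (ε reg))
          (<-trans (m≤m+n 3 3) 6<W) J (λ eq → ne (side-swap y y' c d eq))
          (B.Occurs-⊆ δ o) (B.Occurs-⊆ δ o') (δ (there (there² (here refl))))
        where
        no-Jumpᴮ : ∀ {Δ' j v} → Δ ⊆ Δ' → B.Occurs Δ' j v → Jump (side c d) m (B.edge v) → Refutation W 5 8 Δ'
        no-Jumpᴮ {Δ'} {j} {v} ε oᵥ (a , eq , ne) = raise (m≤m+n 6 2) (meets (side-jump c d a ne))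
          where
          end : End (m , a) (B.edge v)
          end = subst (End (m , a)) (sym eq) (inj₁ refl)
          meets : c ≡ a ⊎ d ≡ a → Refutation W 5 6 Δ'
          meets (inj₁ refl) = disjoint (ε ∘ δ ∘ weaken) oᵥ (R.Occurs-⊆ ε o₀) end (Touches⇒End (R.edge u₀) τ₀)
          meets (inj₂ refl) = disjoint (ε ∘ δ ∘ weaken) oᵥ (R.Occurs-⊆ ε o₁) end (Touches⇒End (R.edge u₁) τ₁)

  no-crossing : ∀ {Γ} m → m ≤ W → G ⊆ Γ → (∀ {Δ} → Γ ⊆ Δ → Unlinked m ∈ Δ → Refutation W 5 60 Δ) →
                Refutation W 5 61 Γ
  no-crossing {Γ} m m≤W g final = chain Unlinked m m≤W Unlinked-bounded
    -- The region x < 0 is empty, so `Unlinked 0` holds vacuously.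
    (raise (m≤m+n 1 59) (by-¬Every (here refl) λ { {(_ , (s , _) , _) , _} _ ((_ , τ , _) , _) → ⊥-elim (none (B.edge s) τ) }))
    (λ i _ → Unlinked-step (there² ∘ g) (here refl) (there (here refl)))
    (final there (here refl))
    where
    none : ∀ e {y} → ¬ Touches 0 e y
    none (hor x a) (() , _)
    none (ver x a) (() , _)

-- The lists that make up the grid, and the frame around it

∈-concatMap : {Y : Set} {f : X → List Y} {x : X} {y : Y} {xs : List X} → x ∈ xs → y ∈ f x → y ∈ concatMap f xs
∈-concatMap i j = ∈-concatMap⁺ _ (lose i j)

∈-keep : {f : X → Bool} {x : X} {xs : List X} → x ∈ xs → T (f x) → x ∈ keep f xs
∈-keep {f = f} {xs = z ∷ _} (here refl) t with f z
... | true = here refl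
∈-keep {f = f} {xs = z ∷ _} (there i) t with f z
... | true = there (∈-keep i t)
... | false = ∈-keep i t

∈-distinctPairs : {x y : X} {xs : List X} → x ∈ xs → y ∈ xs → x ≢ y →
                  (x , y) ∈ distinctPairs xs ⊎ (y , x) ∈ distinctPairs xs
∈-distinctPairs (here refl) (here refl) ne = ⊥-elim (ne refl)
∈-distinctPairs (here refl) (there j) ne = inj₁ (∈-++⁺ˡ (∈-map⁺ _ j))
∈-distinctPairs (there i) (here refl) ne = inj₂ (∈-++⁺ˡ (∈-map⁺ _ i))
∈-distinctPairs {xs = z ∷ xs} (there i) (there j) ne with ∈-distinctPairs i j ne
... | inj₁ k = inj₁ (∈-++⁺ʳ (map (z ,_) xs) k)
... | inj₂ k = inj₂ (∈-++⁺ʳ (map (z ,_) xs) k)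

T-not : ∀ x → ¬ T x → T (not x)
T-not false _ = tt
T-not true ¬t = ¬t tt

Grid : ℕ → Edge → Set
Grid n (hor x y) = (suc x < n) × (y < n)
Grid n (ver x y) = (x < n) × (suc y < n)

<-pred⇒suc< : ∀ {x} n → x < n ∸ 1 → suc x < n
<-pred⇒suc< (suc n) l = s≤s l

∈-edges⇒Grid : ∀ n {e} → e ∈ edges n → Grid n e
∈-edges⇒Grid n i with ∈-++⁻ (concatMap (λ x → map (hor x) (upTo n)) (upTo (n ∸ 1))) i
... | inj₁ j with find (∈-concatMap⁻ (λ x → map (hor x) (upTo n)) {xs = upTo (n ∸ 1)} j)
... | x , x∈ , k with ∈-map⁻ (hor x) k
... | y , y∈ , refl = <-pred⇒suc< n (∈-upTo⁻ x∈) , ∈-upTo⁻ y∈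
∈-edges⇒Grid n i | inj₂ j with find (∈-concatMap⁻ (λ x → map (ver x) (upTo (n ∸ 1))) {xs = upTo n} j)
... | x , x∈ , k with ∈-map⁻ (ver x) k
... | y , y∈ , refl = ∈-upTo⁻ x∈ , <-pred⇒suc< n (∈-upTo⁻ y∈)

∈-points : ∀ {n x y} → x < n → y < n → (x , y) ∈ points n
∈-points x<n y<n = ∈-concatMap (∈-upTo⁺ x<n) (∈-map⁺ _ (∈-upTo⁺ y<n))

End-Grid : ∀ {n x y} e → Grid n e → End (x , y) e → (x < n) × (y < n)
End-Grid (hor x y) (l , l') (inj₁ refl) = <-trans (n<1+n x) l , l'
End-Grid (hor x y) (l , l') (inj₂ refl) = l , l'
End-Grid (ver x y) (l , l') (inj₁ refl) = l , <-trans (n<1+n y) l'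
End-Grid (ver x y) (l , l') (inj₂ refl) = l , l'

-- The grid is moved up by one row, which makes room for the frame below it.
lift : Edge → Edge
lift (hor x y) = hor x (suc y)
lift (ver x y) = ver x (suc y)

lift-injective : ∀ {e e'} → lift e ≡ lift e' → e ≡ e'
lift-injective {hor x y} {hor .x .y} refl = refl
lift-injective {ver x y} {ver .x .y} refl = refl

End-lift⁺ : ∀ {x y} e → End (x , y) e → End (x , suc y) (lift e)
End-lift⁺ (hor x y) (inj₁ refl) = inj₁ refl
End-lift⁺ (hor x y) (inj₂ refl) = inj₂ refl
End-lift⁺ (ver x y) (inj₁ refl) = inj₁ refl
End-lift⁺ (ver x y) (inj₂ refl) = inj₂ refl

End-lift⁻ : ∀ {x z} e → End (x , z) (lift e) → ∃ λ y → (z ≡ suc y) × End (x , y) e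
End-lift⁻ (hor x y) (inj₁ refl) = y , refl , inj₁ refl
End-lift⁻ (hor x y) (inj₂ refl) = y , refl , inj₂ refl
End-lift⁻ (ver x y) (inj₁ refl) = y , refl , inj₁ refl
End-lift⁻ (ver x y) (inj₂ refl) = suc y , refl , inj₂ refl

shareVertex-lift : ∀ e e' → T (shareVertex e e') → T (shareVertex (lift e) (lift e'))
shareVertex-lift e e' t with shareVertex⇒End e e' t
... | p , i , i' = End⇒shareVertex (lift e) (lift e') _ (End-lift⁺ e i) (End-lift⁺ e' i')

-- The l-th edge of the path from (1 + p , y) to (0 , y) along the row y which ends with ver 0 y'.
frame : ℕ → ℕ → ℕ → ℕ → Edge
frame p y y' l with l ≤? p
... | yes _ = hor (p ∸ l) y
... | no _ = ver 0 y'

End-frame : ∀ p y y' l {x z} → End (x , z) (frame p y y' l) → z ≡ y ⊎ End (x , z) (ver 0 y')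
End-frame p y y' l i with l ≤? p
End-frame p y y' l (inj₁ refl) | yes _ = inj₁ refl
End-frame p y y' l (inj₂ refl) | yes _ = inj₁ refl
End-frame p y y' l i | no _ = inj₂ i

frame-last : ∀ p y y' → frame p y y' (suc p) ≡ ver 0 y'
frame-last p y y' with suc p ≤? p
... | yes l = ⊥-elim (<-irrefl refl l)
... | no _ = refl

frame-step : ∀ p y y' l → l ≤ p → End (0 , y) (ver 0 y') → T (shareVertex (frame p y y' l) (frame p y y' (suc l)))
frame-step p y y' l l≤p joint with l ≤? p | suc l ≤? p
... | no ¬l | _ = ⊥-elim (¬l l≤p)
... | yes _ | yes l<p = End⇒shareVertex (hor (p ∸ l) y) (hor (p ∸ suc l) y) (p ∸ l , y) (inj₁ refl)
                          (inj₂ (cong (_, y) (+-∸-assoc 1 l<p)))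
... | yes _ | no l≮p = End⇒shareVertex (hor (p ∸ l) y) (ver 0 y') (0 , y)
                         (inj₁ (cong (_, y) (sym (m≤n⇒m∸n≡0 (≮⇒≥ l≮p))))) joint

Within-frame : ∀ p y y' l → Within (2 + p) (frame p y y' l)
Within-frame p y y' l with l ≤? p
... | yes _ = s≤s (s≤s (m∸n≤m p l))
... | no _ = s≤s z≤n

Touches-frame : ∀ {m z} p y y' l → Touches m (frame p y y' l) z → z ≤ y ⊔ suc y'
Touches-frame p y y' l τ with l ≤? p
Touches-frame p y y' l (_ , refl) | yes _ = m≤m⊔n y (suc y')
Touches-frame p y y' l (_ , inj₁ refl) | no _ = ≤-trans (n≤1+n y') (m≤n⊔m y (suc y'))
Touches-frame p y y' l (_ , inj₂ refl) | no _ = m≤n⊔m y (suc y')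

Within-lift : ∀ {n} e → Grid n e → Within n (lift e)
Within-lift (hor x y) (l , _) = l
Within-lift (ver x y) (l , _) = l

Touches-lift : ∀ {n m z} e → Grid n e → Touches m (lift e) z → z ≤ n
Touches-lift (hor x y) (_ , l) (_ , refl) = l
Touches-lift (ver x y) (_ , l) (_ , inj₁ refl) = <⇒≤ l
Touches-lift (ver x y) (_ , l) (_ , inj₂ refl) = l

lift-Touches : ∀ {p y} e → Grid (2 + p) e → End (suc p , y) e → Touches (2 + p) (lift e) (suc y)
lift-Touches (hor x y) (l , _) (inj₁ refl) = ⊥-elim (<-irrefl refl l)
lift-Touches (hor x y) (l , _) (inj₂ refl) = refl , refl
lift-Touches (ver x y) (l , _) (inj₁ refl) = refl , inj₁ refl
lift-Touches (ver x y) (l , _) (inj₂ refl) = refl , inj₂ refl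

-- `inj₁` marks the grid edges, and `inj₂ l` is the `l`-th step along the frame.
states : ℕ → List (Edge ⊎ ℕ)
states n = map inj₁ (edges n) ++ map inj₂ (upTo n)

inj₁-∈-states : ∀ n {e} → inj₁ e ∈ states n → e ∈ edges n
inj₁-∈-states n i with ∈-++⁻ (map inj₁ (edges n)) i
... | inj₁ j with ∈-map⁻ inj₁ j
... | _ , k , refl = k
inj₁-∈-states n i | inj₂ j with ∈-map⁻ inj₂ j
... | _ , _ , ()

inj₂-∈-states : ∀ n {l} → inj₂ l ∈ states n → l < n
inj₂-∈-states n i with ∈-++⁻ (map inj₁ (edges n)) i
... | inj₂ j with ∈-map⁻ inj₂ j
... | _ , k , refl = ∈-upTo⁻ k
inj₂-∈-states n i | inj₁ j with ∈-map⁻ inj₁ j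
... | _ , _ , ()

-- First the `n` steps along the frame, then the `n * n` positions of the path.
times : ℕ → ℕ
times n = n + n * n

-- The clauses of one colour and the walk they describe

module Clauses (n : ℕ) (col : Edge → ℕ → Atom) (s t : Point) where

  uniqueness : List (Form Atom)
  uniqueness = concatMap (λ i → map (λ ee → ⋁ (neg (col (proj₁ ee) i) ∷ neg (col (proj₂ ee) i) ∷ []))
                                  (distinctPairs (edges n)))
                 (positions n)

  prefix : List (Form Atom)
  prefix = map (λ i → ⋁ (dual (occ n col (suc i)) ∷ occ n col i ∷ [])) (innerPositions n col)

  start : List (Form Atom)
  start = map (λ e → neg (col e 1)) (keep (λ e → not (incident s e)) (edges n))

  connection : List (Form Atom)
  connection = concatMap (λ i → concatMap (λ e → map (λ e' → ⋁ (neg (col e i) ∷ neg (col e' (suc i)) ∷ []))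
                                                   (keep (λ e' → not (shareVertex e e')) (edges n)))
                            (edges n))
                 (innerPositions n col)

  continuation : List (Form Atom)
  continuation = concatMap (λ i → map (λ e → ⋁ (neg (col e i) ∷ occNext n col i ∷ []))
                                    (keep (λ e → not (incident t e)) (edges n)))
                   (positions n)

  clauses : List (Form Atom)
  clauses = uniqueness ++ occ n col 1 ∷ prefix ++ start ++ connection ++ continuation

  occ-clause : occ n col 1 ∈ clauses
  occ-clause = ∈-++⁺ʳ uniqueness (here refl)

  start-clause : ∀ {e} → e ∈ edges n → ¬ T (incident s e) → neg (col e 1) ∈ clauses
  start-clause i ¬t = ∈-++⁺ʳ uniqueness (there (∈-++⁺ʳ prefix (∈-++⁺ˡ
    (∈-map⁺ _ (∈-keep i (T-not _ ¬t))))))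

  connection-clause : ∀ {i e e'} → i < n * n ∸ 1 → e ∈ edges n → e' ∈ edges n → ¬ T (shareVertex e e') →
                      ⋁ (neg (col e (suc i)) ∷ neg (col e' (suc (suc i))) ∷ []) ∈ clauses
  connection-clause {e = e} i<l ie ie' ¬t = ∈-++⁺ʳ uniqueness (there (∈-++⁺ʳ prefix (∈-++⁺ʳ start (∈-++⁺ˡ
    (∈-concatMap (∈-map⁺ suc (∈-upTo⁺ i<l)) (∈-concatMap {x = e} ie (∈-map⁺ _ (∈-keep ie' (T-not _ ¬t)))))))))

  continuation-clause : ∀ {i e} → i < n * n → e ∈ edges n → ¬ T (incident t e) →
                        ⋁ (neg (col e (suc i)) ∷ occNext n col (suc i) ∷ []) ∈ clauses
  continuation-clause i<l ie ¬t = ∈-++⁺ʳ uniqueness (there (∈-++⁺ʳ prefix (∈-++⁺ʳ start (∈-++⁺ʳ connection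
    (∈-concatMap (∈-map⁺ suc (∈-upTo⁺ i<l)) (∈-map⁺ _ (∈-keep ie (T-not _ ¬t))))))))

  occNext-< : ∀ {i} → i < n * n → occNext n col i ≡ occ n col (suc i)
  occNext-< {i} l with i <ᵇ n * n | <⇒<ᵇ l
  ... | true | _ = refl

  occNext-last : occNext n col (n * n) ≡ ⋁ []
  occNext-last with n * n <ᵇ n * n | <ᵇ⇒< (n * n) (n * n)
  ... | true | l = ⊥-elim (<-irrefl refl (l tt))
  ... | false | _ = refl

  uniqueness-clause : ∀ {i e e'} → i < n * n → (e , e') ∈ distinctPairs (edges n) →
                      ⋁ (neg (col e (suc i)) ∷ neg (col e' (suc i)) ∷ []) ∈ clauses
  uniqueness-clause i<l ie = ∈-++⁺ˡ (∈-concatMap (∈-map⁺ suc (∈-upTo⁺ i<l)) (∈-map⁺ _ ie))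

-- One of the two coloured paths, preceded by the path along the frame, which takes n steps.
module Coloured (p : ℕ) (W : ℕ) (G : List (Form Atom)) (col : Edge → ℕ → Atom) (s t y y' : ℕ)
  (path : isPath (2 + p) col (0 , s) (suc p , t) ∈ G)
  (joint : End (0 , y) (ver 0 y')) (corner : End (0 , suc s) (ver 0 y'))
  (low : y ⊔ suc y' < 4 + p)
  (few-times : times (2 + p) < W) (few-states : length (states (2 + p)) < W)
  (few-pairs : length (cartesianProduct (upTo (times (2 + p))) (states (2 + p))) < W)
  where

  n : ℕ
  n = 2 + p

  open Clauses n col (0 , s) (suc p , t)

  edge : Edge ⊎ ℕ → Edge
  edge (inj₁ e) = lift e
  edge (inj₂ l) = frame p y y' l

  -- The way along the frame is fixed in advance, so its formulas are constants. Positions of a path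
  -- count from 1, hence time `n` is position `suc 0`.
  at : ℕ → Edge ⊎ ℕ → Form Atom
  at k (inj₁ e) = only (n ≤? k) (pos (col e (suc (k ∸ n))))
  at k (inj₂ l) = only (k ≟ l) (⋀ [])

  clash-two : ∀ {W D h} {Γ : List (Form Atom)} {α α'} → ⋁ (neg α ∷ neg α' ∷ []) ∈ Γ → pos α ∈ Γ → pos α' ∈ Γ →
              Refutation W D (suc h) Γ
  clash-two c q q' = cases c λ
    { (here refl) → clash (there q) (here refl)
    ; (there (here refl)) → clash (there q') (here refl) }

  real-time : ∀ {k} → n ≤ k → k < times n → k ∸ n < n * n
  real-time {k} n≤k k<L = +-cancelˡ-< n _ _ (subst (_< times n) (sym (m+[n∸m]≡n n≤k)) k<L)

  module _ {Γ : List (Form Atom)} (g : G ⊆ Γ) where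

    step : ∀ {k s s'} → k < times n → suc k < times n → s ∈ states n → s' ∈ states n → at k s ∈ Γ → at (suc k) s' ∈ Γ →
           ¬ T (shareVertex (edge s) (edge s')) → Refutation W 5 6 Γ
    step {k} {inj₁ e} {inj₁ e'} _ l i i' q q' ¬t with n ≤? k | n ≤? suc k
    ... | no _ | _ = absurd q
    ... | yes _ | no _ = absurd q'
    ... | yes n≤k | yes _ = raise (m≤m+n 2 4)
      (select (g path) (connection-clause {k ∸ n} bound (inj₁-∈-states n i) (inj₁-∈-states n i') (¬t ∘ shareVertex-lift e e'))
        (clash-two (here refl) (there q) (there (subst (λ j → pos (col e' (suc j)) ∈ Γ) (+-∸-assoc 1 n≤k) q'))))
      where
      bound : k ∸ n < n * n ∸ 1
      bound = ∸-monoˡ-≤ 1 (subst (_< n * n) (+-∸-assoc 1 n≤k) (real-time (≤-trans n≤k (n≤1+n k)) l))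
    step {k} {inj₁ e} {inj₂ l} _ _ i i' q q' ¬t with n ≤? k | suc k ≟ l
    ... | no _ | _ = absurd q
    ... | yes _ | no _ = absurd q'
    ... | yes n≤k | yes refl = ⊥-elim (<-asym (inj₂-∈-states n i') (s≤s n≤k))
    step {k} {inj₂ l} {inj₁ e} _ _ i i' q q' ¬t with k ≟ l | n ≤? suc k
    ... | no _ | _ = absurd q
    ... | yes _ | no _ = absurd q'
    -- The passage from the frame to the path: the frame has reached its vertical edge, one end of
    -- which is the lifted corner `(0 , suc s)` where the first edge of the path has to begin.
    ... | yes refl | yes n≤1+k with ≤-antisym (inj₂-∈-states n i) n≤1+k
    ... | refl = raise (m≤m+n 1 5) (select (g path) (start-clause (inj₁-∈-states n i') λ t → ¬t
        (End⇒shareVertex (frame p y y' (suc p)) (lift e) (0 , suc s)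
          (subst (End (0 , suc s)) (sym (frame-last p y y')) corner) (End-lift⁺ e (incident⇒End _ e t))))
        (clash (there (subst (λ j → pos (col e (suc j)) ∈ Γ) (n∸n≡0 p) q')) (here refl)))
    step {k} {inj₂ l} {inj₂ l'} _ _ i i' q q' ¬t with k ≟ l | suc k ≟ l'
    ... | no _ | _ = absurd q
    ... | yes _ | no _ = absurd q'
    ... | yes refl | yes refl = ⊥-elim (¬t (frame-step p y y' k (≤-pred (≤-pred (inj₂-∈-states n i'))) joint))

    unique : ∀ {k s s'} → k < times n → s ∈ states n → s' ∈ states n → at k s ∈ Γ → at k s' ∈ Γ →
             edge s ≢ edge s' → Refutation W 5 6 Γ
    unique {k} {inj₁ e} {inj₁ e'} l i i' q q' ne with n ≤? k
    ... | no _ = absurd q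
    ... | yes n≤k with ∈-distinctPairs {xs = edges n} (inj₁-∈-states n i) (inj₁-∈-states n i') (ne ∘ cong lift)
    ... | inj₁ j = raise (m≤m+n 2 4) (select (g path) (uniqueness-clause (real-time n≤k l) j)
                     (clash-two (here refl) (there q) (there q')))
    ... | inj₂ j = raise (m≤m+n 2 4) (select (g path) (uniqueness-clause (real-time n≤k l) j)
                     (clash-two (here refl) (there q') (there q)))
    unique {k} {inj₁ e} {inj₂ l} _ i i' q q' ne with n ≤? k | k ≟ l
    ... | no _ | _ = absurd q
    ... | yes _ | no _ = absurd q'
    ... | yes n≤k | yes refl = ⊥-elim (<-irrefl refl (<-≤-trans (inj₂-∈-states n i') n≤k))
    unique {k} {inj₂ l} {inj₁ e} _ i i' q q' ne with n ≤? k | k ≟ l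
    ... | no _ | _ = absurd q'
    ... | yes _ | no _ = absurd q
    ... | yes n≤k | yes refl = ⊥-elim (<-irrefl refl (<-≤-trans (inj₂-∈-states n i) n≤k))
    unique {k} {inj₂ l} {inj₂ l'} _ i i' q q' ne with k ≟ l | k ≟ l'
    ... | no _ | _ = absurd q
    ... | yes _ | no _ = absurd q'
    ... | yes refl | yes refl = ⊥-elim (ne refl)

    -- The starting corner is the only point that the frame shares with the lifted grid. A meeting
    -- there has to be turned into a meeting with a genuine edge of the path.
    by-first-edge : (∀ {e} → e ∈ edges n → End (0 , s) e → ∀ {Δ} → Γ ⊆ Δ → pos (col e 1) ∈ Δ → Refutation W 5 h Δ) →
                    Refutation W 5 (3 + h) Γ
    by-first-edge {h} f = select (g path) occ-clause (cases (here refl) go)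
      where
      go : ∀ {φ} → φ ∈ map (λ e → pos (col e 1)) (edges n) → Refutation W 5 (suc h) (φ ∷ occ n col 1 ∷ Γ)
      go i with ∈-map⁻ (λ e → pos (col e 1)) i
      ... | e , j , refl with Bool.T? (incident (0 , s) e)
      ... | yes t = raise (n≤1+n h) (f j (incident⇒End _ e t) there² (here refl))
      ... | no ¬t = select (there² (g path)) (start-clause j ¬t) (clash (there (here refl)) (here refl))

  walk : Walk W (times n) G
  walk = record
    { State = Edge ⊎ ℕ
    ; states = states n
    ; edge = edge
    ; at = at
    ; at-bounded = at-bounded
    ; rows = 4 + p
    ; below = λ {state} → below {state}
    ; few-times = few-times
    ; few-states = few-states
    ; few-pairs = few-pairs
    ; step = λ {_} {_} {u} {u'} g (l , i , q) (l' , i' , q') → step g {s = u} {u'} l l' i i' q q'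
    ; unique = λ {_} {_} {u} {u'} g (l , i , q) (_ , i' , q') → unique g {s = u} {u'} l i i' q q'
    }
    where
    at-bounded : ∀ k u → Bounded W 1 (at k u)
    at-bounded k (inj₁ e) with n ≤? k
    ... | yes _ = pos
    ... | no _ = ⋁ (≤-trans (s≤s z≤n) few-times) (λ ())
    at-bounded k (inj₂ l) with k ≟ l
    ... | yes _ = ⋀ (≤-trans (s≤s z≤n) few-times) (λ ())
    ... | no _ = ⋁ (≤-trans (s≤s z≤n) few-times) (λ ())
    below : ∀ {u m z} → u ∈ states n → Touches m (edge u) z → z < 4 + p
    below {inj₁ e} i τ = s≤s (≤-trans (Touches-lift e (∈-edges⇒Grid n (inj₁-∈-states n i)) τ) (n≤1+n _))
    below {inj₂ l} i τ = ≤-<-trans (Touches-frame p y y' l τ) low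

  open Walk walk using (Inside; Remains; Inside-bounded; Remains-bounded)

  at-real : ∀ {k e} → n ≤ k → at k (inj₁ e) ≡ pos (col e (suc (k ∸ n)))
  at-real {k} n≤k with n ≤? k
  ... | yes _ = refl
  ... | no n≰k = ⊥-elim (n≰k n≤k)

  at-frame : ∀ k → at k (inj₂ k) ≡ ⋀ []
  at-frame k with k ≟ k
  ... | yes _ = refl
  ... | no k≢k = ⊥-elim (k≢k refl)

  ∈-states-real : ∀ {e} → e ∈ edges n → inj₁ e ∈ states n
  ∈-states-real i = ∈-++⁺ˡ (∈-map⁺ inj₁ i)

  ∈-states-frame : ∀ {l} → l < n → inj₂ l ∈ states n
  ∈-states-frame l<n = ∈-++⁺ʳ (map inj₁ (edges n)) (∈-map⁺ inj₂ (∈-upTo⁺ l<n))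

  occ-Inside : ∀ {Γ k} → n ≤ k → occ n col (suc (k ∸ n)) ∈ Γ → dual (Inside n k) ∈ Γ → Refutation W 5 2 Γ
  occ-Inside {Γ} {k} n≤k q q' = cases q go
    where
    go : ∀ {φ} → φ ∈ map (λ e → pos (col e (suc (k ∸ n)))) (edges n) → Refutation W 5 1 (φ ∷ Γ)
    go i with ∈-map⁻ (λ e → pos (col e (suc (k ∸ n)))) i
    ... | e , j , refl = by-¬Some (there q') {x = inj₁ e} (∈-states-real j) (Within-lift e (∈-edges⇒Grid n j))
      (clash (there (here refl)) (here (cong dual (sym (at-real {k} {e} n≤k)))))

  module _ {Γ : List (Form Atom)} (g : G ⊆ Γ)
    (arrived : ∀ {Δ k e} → Γ ⊆ Δ → n ≤ k → k < times n → Remains n 0 k ∈ Δ → e ∈ edges n → T (incident (suc p , t) e) →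
               at k (inj₁ e) ∈ Δ → Refutation W 5 h Δ) where

    -- As long as the current edge misses the target corner, its continuation clause yields an edge
    -- at the next position.
    visit : ∀ {Δ k h'} → Γ ⊆ Δ → n ≤ k → k < times n → Remains n 0 k ∈ Δ →
            (∀ {Δ'} → Δ ⊆ Δ' → occNext n col (suc (k ∸ n)) ∈ Δ' → Refutation W 5 (h' + h) Δ') →
            Refutation W 5 (4 + (h' + h)) Δ
    visit {Δ} {k} {h'} γ n≤k k<L q next =
      by-Every q (∈-upTo⁺ k<L) (z≤n , ≤-refl) (by-Some (here refl) λ {u} i _ → go u i)
      where
      go : ∀ u → u ∈ states n → Refutation W 5 (2 + (h' + h)) (at k u ∷ Inside n k ∷ Δ)
      go (inj₁ e) i with Bool.T? (incident (suc p , t) e)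
      ... | yes t = raise (m≤n+m h (2 + h')) (arrived (there² ∘ γ) n≤k k<L (there² q) (inj₁-∈-states n i) t (here refl))
      ... | no ¬t = select (there² (g' path)) (continuation-clause (real-time n≤k k<L) (inj₁-∈-states n i) ¬t)
        (cases (here refl) λ
          { (here refl) → clash (there² (here (sym (at-real {k} {e} n≤k)))) (here refl)
          ; (there (here refl)) → next there⁴ (here refl) })
        where
        g' : G ⊆ Δ
        g' = γ ∘ g
      go (inj₂ l) i with k ≟ l
      ... | no _ = absurd (here refl)
      ... | yes refl = ⊥-elim (<-irrefl refl (<-≤-trans (inj₂-∈-states n i) n≤k))

    -- By induction on the time, the path does not end before it reaches the corner (1 + p , t).
    arrive : Refutation W 5 (11 + h) Γ
    -- The interval starts at time 0 and thus includes the frame, so upon arrival this formula is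
    -- just the `Remains` that the final chord requires.
    arrive = chain (λ j → Remains n 0 (n + j)) (n * n ∸ 1)
        (≤-trans (m∸n≤m (n * n) 1) (<⇒≤ (≤-<-trans (m≤n+m (n * n) n) few-times)))
        (λ j → Bounded-mono (s≤s (s≤s (s≤s z≤n))) (Remains-bounded n 0 (n + j)))
        first further last
      where
      first : Refutation W 5 (10 + h) (dual (Remains n 0 (n + 0)) ∷ Γ)
      first = by-¬Every (here refl) λ {j} _ (_ , j≤n) → at-start j j≤n
        where
        at-start : ∀ j → j ≤ n + 0 → Refutation W 5 (9 + h) (dual (Inside n j) ∷ dual (Remains n 0 (n + 0)) ∷ Γ)
        at-start j j≤n with n ≤? j
        ... | no n≰j = by-¬Some (here refl) {x = inj₂ j} (∈-states-frame (≰⇒> n≰j)) (Within-frame p y y' j)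
                         (absurd (here (cong dual (sym (at-frame j)))))
        ... | yes n≤j = select (there² (g path)) occ-clause
          (raise (m≤m+n 2 (6 + h)) (occ-Inside n≤j (here (cong (occ n col ∘ suc) j∸n≡0)) (there (here refl))))
          where
          j∸n≡0 : j ∸ n ≡ 0
          j∸n≡0 = m≤n⇒m∸n≡0 (subst (j ≤_) (+-identityʳ n) j≤n)
      further : ∀ j → j < n * n ∸ 1 → Refutation W 5 (10 + h) (Remains n 0 (n + j) ∷ dual (Remains n 0 (n + suc j)) ∷ Γ)
      further j j<l = visit {h' = 6} there² (m≤m+n n j) (+-monoʳ-< n (<-≤-trans j<l (m∸n≤m (n * n) 1))) (here refl) next
        where
        1+j<n*n : suc j < n * n
        1+j<n*n = <-pred⇒suc< (n * n) j<l
        next : ∀ {Δ} → Remains n 0 (n + j) ∷ dual (Remains n 0 (n + suc j)) ∷ Γ ⊆ Δ → occNext n col (suc (n + j ∸ n)) ∈ Δ →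
               Refutation W 5 (6 + h) Δ
        next {Δ} δ q = by-¬Every (δ (there (here refl))) λ {i} i∈ (_ , i≤) → still i i∈ i≤ (m≤n⇒m<n∨m≡n i≤)
          where
          occ-next : occ n col (suc (suc j)) ∈ Δ
          occ-next = subst (_∈ Δ) (trans (cong (occNext n col ∘ suc) (m+n∸m≡n n j)) (occNext-< 1+j<n*n)) q
          still : ∀ i → i ∈ upTo (times n) → i ≤ n + suc j → i < n + suc j ⊎ i ≡ n + suc j →
                  Refutation W 5 (5 + h) (dual (Inside n i) ∷ Δ)
          still i i∈ _ (inj₁ i<) = by-Every (there (δ (here refl))) i∈ (z≤n , ≤-pred (subst (i <_) (+-suc n j) i<))
            (raise (m≤m+n 4 h) (contradict 2 (Inside-bounded n i) (here refl) (there (here refl))))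
          still i i∈ _ (inj₂ refl) = raise (m≤m+n 2 (3 + h)) (occ-Inside (m≤m+n n (suc j))
            (there (subst (λ z → occ n col (suc z) ∈ Δ) (sym (m+n∸m≡n n (suc j))) occ-next)) (here refl))
      -- At position `n * n` the formula `occNext` is the empty disjunction.
      last : Refutation W 5 (10 + h) (Remains n 0 (n + (n * n ∸ 1)) ∷ Γ)
      last = visit {h' = 6} there (m≤m+n n _) (+-monoʳ-< n (n<1+n _)) (here refl) stop
        where
        stop : ∀ {Δ} → Remains n 0 (n + (n * n ∸ 1)) ∷ Γ ⊆ Δ → occNext n col (suc (n + (n * n ∸ 1) ∸ n)) ∈ Δ →
               Refutation W 5 (6 + h) Δ
        stop {Δ} _ q = absurd (subst (_∈ Δ) (trans (cong (occNext n col ∘ suc) (m+n∸m≡n n (n * n ∸ 1))) occNext-last) q)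

-- The two framed paths of a square

overlaps : ℕ → List (Form Atom)
overlaps n = concatMap (λ q → concatMap (λ e → concatMap (λ e' → concatMap (λ i → map (λ j →
      ⋀ (pos (b e i) ∷ pos (r e' j) ∷ []))
    (positions n)) (positions n))
    (keep (incident q) (edges n)))
    (keep (incident q) (edges n)))
  (points n)

∈-overlaps : ∀ n {i j e e' q} → i < n * n → j < n * n → e ∈ edges n → e' ∈ edges n → End q e → End q e' →
             ⋀ (pos (b e (suc i)) ∷ pos (r e' (suc j)) ∷ []) ∈ overlaps n
∈-overlaps n {i} {j} {e} {e'} {q} i< j< ie ie' ε ε' =
  ∈-concatMap point
    (∈-concatMap {x = e} (∈-keep {f = incident q} ie (End⇒incident q e ε))
      (∈-concatMap {x = e'} (∈-keep {f = incident q} ie' (End⇒incident q e' ε'))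
        (∈-concatMap {x = suc i} (∈-map⁺ suc (∈-upTo⁺ i<))
          (∈-map⁺ (λ j → ⋀ (pos (b e (suc i)) ∷ pos (r e' j) ∷ [])) (∈-map⁺ suc (∈-upTo⁺ j<))))))
  where
  point : q ∈ points n
  point with End-Grid e (∈-edges⇒Grid n ie) ε
  ... | l , l' = ∈-points l l'

module Square (p W : ℕ) (6<W : 6 < W) (n<W : 2 + p < W)
  (few-times : times (2 + p) < W) (few-states : length (states (2 + p)) < W)
  (few-pairs : length (cartesianProduct (upTo (times (2 + p))) (states (2 + p))) < W)
  where

  n : ℕ
  n = 2 + p

  G : List (Form Atom)
  G = isPath n b (0 , 0) (suc p , suc p) ∷ isPath n r (0 , suc p) (suc p , 0) ∷ dual (sharePoint n) ∷ []

  module Blue = Coloured p W G b 0 (suc p) 0 0 (here refl) (inj₁ refl) (inj₂ refl)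
                  (s≤s (s≤s z≤n)) few-times few-states few-pairs
  module Red = Coloured p W G r (suc p) 0 (suc n) n (there (here refl)) (inj₂ refl) (inj₁ refl)
                 (subst (_< 4 + p) (sym (⊔-idem (3 + p))) ≤-refl) few-times few-states few-pairs

  module B = Walk Blue.walk
  module R = Walk Red.walk

  disjoint-atoms : ∀ {Γ i j e e' q} → G ⊆ Γ → i < n * n → j < n * n → e ∈ edges n → e' ∈ edges n →
                   End q e → End q e' → pos (b e (suc i)) ∈ Γ → pos (r e' (suc j)) ∈ Γ → Refutation W 5 3 Γ
  disjoint-atoms {i = i} {j} {e} {e'} {q} g i< j< ie ie' ε ε' p p' =
    raise (s≤s (s≤s z≤n)) (select (g (there (there (here refl)))) (∈-dualL⁺ (∈-overlaps n i< j< ie ie' ε ε'))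
      (cases (here refl) λ
        { (here refl) → clash (there² p) (here refl)
        ; (there (here refl)) → clash (there² p') (here refl) }))

  -- The lifted grid occupies the rows 1 to `n`, the frames the rows 0 and `n + 1` and one vertical
  -- edge each. So a frame can meet the other walk only in its own starting corner, where
  -- `by-first-edge` replaces it by the first edge of its path; this detour makes up the rank 6 = 3
  -- + 3.
  disjoint : ∀ {Γ k s l t q} → G ⊆ Γ → B.Occurs Γ k s → R.Occurs Γ l t →
             End q (Blue.edge s) → End q (Red.edge t) → Refutation W 5 6 Γ
  disjoint {k = k} {inj₁ e} {l} {inj₁ e'} g (k<L , i , p) (l<L , i' , p') ε ε' with n ≤? k | n ≤? l
  ... | no _ | _ = absurd p
  ... | yes _ | no _ = absurd p'
  ... | yes n≤k | yes n≤l with End-lift⁻ e ε | End-lift⁻ e' ε'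
  ... | _ , refl , η | _ , refl , η' = raise (m≤m+n 3 3)
    (disjoint-atoms g (Blue.real-time n≤k k<L) (Red.real-time n≤l l<L) (inj₁-∈-states n i) (inj₁-∈-states n i') η η' p p')
  disjoint {k = k} {inj₁ e} {l} {inj₂ f} g (k<L , i , p) (l<L , i' , p') ε ε'
    with n ≤? k | End-lift⁻ e ε | End-frame _ (suc n) n f ε'
  ... | no _ | _ | _ = absurd p
  ... | yes n≤k | _ , refl , η | inj₁ refl = ⊥-elim (<-irrefl refl (proj₂ (End-Grid e (∈-edges⇒Grid n (inj₁-∈-states n i)) η)))
  ... | yes n≤k | _ , refl , η | inj₂ (inj₂ refl) = ⊥-elim (<-irrefl refl (proj₂ (End-Grid e (∈-edges⇒Grid n (inj₁-∈-states n i)) η)))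
  ... | yes n≤k | _ , refl , η | inj₂ (inj₁ refl) = Red.by-first-edge g λ i'' η'' δ p'' →
    disjoint-atoms (δ ∘ g) (Blue.real-time n≤k k<L) (s≤s z≤n) (inj₁-∈-states n i) i'' η η'' (δ p) p''
  disjoint {k = k} {inj₂ f} {l} {inj₁ e'} g (k<L , i , p) (l<L , i' , p') ε ε'
    with n ≤? l | End-lift⁻ e' ε' | End-frame _ 0 0 f ε
  ... | no _ | _ | _ = absurd p'
  ... | yes n≤l | _ , refl , η | inj₁ ()
  ... | yes n≤l | _ , refl , η | inj₂ (inj₁ ())
  ... | yes n≤l | _ , refl , η | inj₂ (inj₂ refl) = Blue.by-first-edge g λ i'' η'' δ p'' →
    disjoint-atoms (δ ∘ g) (s≤s z≤n) (Red.real-time n≤l l<L) i'' (inj₁-∈-states n i') η'' η p'' (δ p')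
  disjoint {s = inj₂ f} {t = inj₂ f'} g _ _ ε ε' with End-frame _ 0 0 f ε | End-frame _ (suc n) n f' ε'
  ... | inj₁ refl | inj₁ ()
  ... | inj₁ refl | inj₂ (inj₁ ())
  ... | inj₁ refl | inj₂ (inj₂ ())
  ... | inj₂ (inj₁ refl) | inj₁ ()
  ... | inj₂ (inj₁ refl) | inj₂ (inj₁ ())
  ... | inj₂ (inj₁ refl) | inj₂ (inj₂ ())
  ... | inj₂ (inj₂ refl) | inj₁ ()
  ... | inj₂ (inj₂ refl) | inj₂ (inj₁ ())
  ... | inj₂ (inj₂ refl) | inj₂ (inj₂ ())

  module _ (few-chords : length (cartesianProduct B.chords R.chords) < W) where

    -- The frames start on the last column at the heights 0 and n + 1, the paths end there at the heights
    -- n and 1.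
    ends-interleave : Interleave (0 , n) (suc n , 1)
    ends-interleave = go (suc n <ᵇ n) (<ᵇ⇒< (suc n) n)
      where
      go : ∀ x → (T x → suc n < n) → (false xor false) ≢ (x xor true)
      go false _ ()
      go true l _ = <-asym (l tt) (n<1+n n)

    module C = Crossing Blue.walk Red.walk disjoint few-chords 6<W

    refutation : Refutation W 5 65 (dual (STSEQ n) ∷ [])
    refutation = select (here refl) (here refl) (select (there (here refl)) (there (here refl))
      (select (there² (here refl)) (there (there (here refl)))
      -- A cut with the constant true makes `⋀ []` a hypothesis. It is the formula `at 0 (inj₂ 0)`
      -- of both walks, which says that they start on their frames.
      (chain (λ _ → ⋀ []) 0 z≤n (λ _ → ⋀ (≤-trans (s≤s z≤n) 6<W) (λ ())) (absurd (here refl)) (λ _ ())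
      (C.no-crossing n (<⇒≤ n<W) base final))))
      where
      Γ₀ : List (Form Atom)
      Γ₀ = ⋀ [] ∷ dual (sharePoint n) ∷ dual (dual (isPath n r (0 , suc p) (suc p , 0))) ∷
           dual (dual (isPath n b (0 , 0) (suc p , suc p))) ∷ dual (STSEQ n) ∷ []
      base : G ⊆ Γ₀
      base (here refl) = there (there² (here (sym (dual-involutive (isPath n b (0 , 0) (suc p , suc p))))))
      base (there (here refl)) = there² (here (sym (dual-involutive (isPath n r (0 , suc p) (suc p , 0)))))
      base (there (there (here refl))) = there (here refl)
      final : ∀ {Δ} → Γ₀ ⊆ Δ → C.Unlinked n ∈ Δ → Refutation W 5 60 Δ
      -- The rank is 11 for each of the two arrivals and 8 for `apply-Unlinked`.
      final δ u = raise (m≤m+n 30 30)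
        (Blue.arrive (δ ∘ base) λ {_} {k} {e} γ n≤k k<L reg e∈ t q →
         Red.arrive (γ ∘ δ ∘ base) λ {_} {l} {f} γ' n≤l l<L reg' f∈ t' q' →
         C.apply-Unlinked (γ' (γ u))
           (z≤n , (cong (2 +_) refl , refl) , lift-Touches e (∈-edges⇒Grid n e∈) (incident⇒End (suc p , suc p) e t))
           (z≤n , (cong (2 +_) refl , refl) , lift-Touches f (∈-edges⇒Grid n f∈) (incident⇒End (suc p , 0) f t'))
           ends-interleave
           (s≤s z≤n , Blue.∈-states-frame (s≤s z≤n) , γ' (γ (δ (here refl))))
           (k<L , Blue.∈-states-real e∈ , γ' q) (γ' reg)
           (s≤s z≤n , Red.∈-states-frame (s≤s z≤n) , γ' (γ (δ (here refl))))
           (l<L , Red.∈-states-real f∈ , q') reg')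

-- Bounds on lengths, widths and depths

module Lengths (N : ℕ) (2<N : 2 < N) where

  instance
    N≢0 : NonZero N
    N≢0 = >-nonZero (≤-trans (s≤s z≤n) 2<N)

  record Short {X : Set} (a : ℕ) (xs : List X) : Set where
    constructor short
    field
      bound : length xs ≤ N ^ a
  open Short public

  Short-mono : ∀ {a a'} {xs : List X} → a ≤ a' → Short a xs → Short a' xs
  Short-mono a≤a' (short l) = short (≤-trans l (^-monoʳ-≤ N a≤a'))

  -- All bounds are kept as powers of `N`; since `N` exceeds 2, a sum costs only one more in the
  -- exponent.
  double : ∀ a {x y} → x ≤ N ^ a → y ≤ N ^ a → x + y ≤ N ^ suc a
  double a {x} {y} l l' = begin
    x + y            ≤⟨ +-mono-≤ l (≤-trans l' (m≤m+n (N ^ a) 0)) ⟩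
    2 * N ^ a        ≤⟨ *-monoˡ-≤ (N ^ a) (<⇒≤ 2<N) ⟩
    N * N ^ a        ∎
    where open ≤-Reasoning

  product : ∀ a c {x y} → x ≤ N ^ a → y ≤ N ^ c → x * y ≤ N ^ (a + c)
  product a c l l' = ≤-trans (*-mono-≤ l l') (≤-reflexive (sym (^-distribˡ-+-* N a c)))

  Short-++ : ∀ a {xs ys : List X} → Short a xs → Short a ys → Short (suc a) (xs ++ ys)
  Short-++ a {xs} (short l) (short l') = short (subst (_≤ _) (sym (length-++ xs)) (double a l l'))

  Short-∷ : ∀ a {x : X} {xs} → Short a xs → Short (suc a) (x ∷ xs)
  Short-∷ a (short l) = short (double a (m^n>0 N a) l)

  Short-map : ∀ a {Y : Set} {f : X → Y} {xs} → Short a xs → Short a (map f xs)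
  Short-map a {f = f} {xs} (short l) = short (subst (_≤ N ^ a) (sym (length-map f xs)) l)

  Short-concatMap : ∀ a c {Y : Set} {f : X → List Y} {xs} → Short a xs → (∀ x → Short c (f x)) →
                    Short (a + c) (concatMap f xs)
  Short-concatMap a c {f = f} {xs} (short l) l' = short (≤-trans (go xs) (product a c l ≤-refl))
    where
    go : ∀ xs → length (concatMap f xs) ≤ length xs * N ^ c
    go [] = z≤n
    go (x ∷ xs) = subst (_≤ _) (sym (length-++ (f x))) (+-mono-≤ (bound (l' x)) (go xs))

  Short-cartesianProduct : ∀ a c {Y : Set} {xs : List X} {ys : List Y} → Short a xs → Short c ys →
                           Short (a + c) (cartesianProduct xs ys)
  Short-cartesianProduct a c {xs = xs} {ys} (short l) (short l') = short (≤-trans (go xs) (product a c l l'))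
    where
    go : ∀ xs → length (cartesianProduct xs ys) ≤ length xs * length ys
    go [] = z≤n
    go (x ∷ xs) = subst (_≤ _) (sym (length-++ (map (x ,_) ys)))
      (+-mono-≤ (≤-reflexive (length-map (x ,_) ys)) (go xs))

  Short-keep : ∀ a {f : X → Bool} {xs} → Short a xs → Short a (keep f xs)
  Short-keep a {f} {xs} (short l) = short (≤-trans (go xs) l)
    where
    go : ∀ xs → length (keep f xs) ≤ length xs
    go [] = z≤n
    go (x ∷ xs) with f x
    ... | true = s≤s (go xs)
    ... | false = m≤n⇒m≤1+n (go xs)

  Short-distinctPairs : ∀ a {xs : List X} → Short a xs → Short (a + a) (distinctPairs xs)
  Short-distinctPairs a {xs} (short l) = short (≤-trans (go xs) (product a a l l))
    where
    go : ∀ {X : Set} (xs : List X) → length (distinctPairs xs) ≤ length xs * length xs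
    go [] = z≤n
    go (x ∷ xs) = subst (_≤ _) (sym (length-++ (map (x ,_) xs))) (begin
      length (map (x ,_) xs) + length (distinctPairs xs)    ≤⟨ +-mono-≤ (≤-reflexive (length-map (x ,_) xs)) (go xs) ⟩
      length xs + length xs * length xs                     ≤⟨ *-monoʳ-≤ (suc (length xs)) (n≤1+n (length xs)) ⟩
      suc (length xs) * suc (length xs)                     ∎)
      where open ≤-Reasoning

  Short-upTo : ∀ a {l} → l ≤ N ^ a → Short a (upTo l)
  Short-upTo a {l} le = short (subst (_≤ N ^ a) (sym (length-upTo l)) le)

module Sizes (n N : ℕ) (3+n≤N : 3 + n ≤ N) where

  open Lengths N (m+n≤o⇒m≤o 3 3+n≤N) public

  n≤N : n ≤ N ^ 1
  n≤N = subst (n ≤_) (sym (*-identityʳ N)) (m+n≤o⇒n≤o 3 3+n≤N)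

  3≤N¹ : 3 ≤ N ^ 1
  3≤N¹ = subst (3 ≤_) (sym (*-identityʳ N)) (m+n≤o⇒m≤o 3 3+n≤N)

  2≤N¹ : 2 ≤ N ^ 1
  2≤N¹ = <⇒≤ 3≤N¹

  n*n≤N² : n * n ≤ N ^ 2
  n*n≤N² = product 1 1 n≤N n≤N

  times≤N³ : times n ≤ N ^ 3
  times≤N³ = double 2 (≤-trans n≤N (^-monoʳ-≤ N {1} {2} (s≤s z≤n))) n*n≤N²

  Short-edges : Short 3 (edges n)
  Short-edges = Short-++ 2
    (Short-concatMap 1 1 (Short-upTo 1 n∸1≤N) (λ x → Short-map 1 (Short-upTo 1 n≤N)))
    (Short-concatMap 1 1 (Short-upTo 1 n≤N) (λ x → Short-map 1 (Short-upTo 1 n∸1≤N)))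
    where
    n∸1≤N : n ∸ 1 ≤ N ^ 1
    n∸1≤N = ≤-trans (m∸n≤m n 1) n≤N

  Short-positions : Short 2 (positions n)
  Short-positions = Short-map 2 (Short-upTo 2 n*n≤N²)

  Short-innerPositions : ∀ col → Short 2 (innerPositions n col)
  Short-innerPositions col = Short-map 2 (Short-upTo 2 (≤-trans (m∸n≤m (n * n) 1) n*n≤N²))

  Short-states : Short 4 (states n)
  Short-states = Short-++ 3 (Short-map 3 Short-edges)
    (Short-map 3 (Short-mono (s≤s z≤n) (Short-upTo 1 n≤N)))

  Short-times : Short 3 (upTo (times n))
  Short-times = Short-upTo 3 times≤N³

  Short-pairs : Short 7 (cartesianProduct (upTo (times n)) (states n))
  Short-pairs = Short-cartesianProduct 3 4 Short-times Short-states

  allChords : List ((ℕ × ℕ) × ((Edge ⊎ ℕ) × (Edge ⊎ ℕ)) × (ℕ × ℕ))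
  allChords = cartesianProduct (cartesianProduct (upTo (times n)) (upTo (times n)))
                (cartesianProduct (cartesianProduct (states n) (states n))
                  (cartesianProduct (upTo (2 + n)) (upTo (2 + n))))

  -- The exponent is 3 + 3 for the times, 4 + 4 for the states and 1 + 1 for the heights.
  Short-chords : Short 16 allChords
  Short-chords =
    Short-cartesianProduct 6 10 (Short-cartesianProduct 3 3 Short-times Short-times)
      (Short-cartesianProduct 8 2 (Short-cartesianProduct 4 4 Short-states Short-states)
        (Short-cartesianProduct 1 1 (Short-upTo 1 rows≤N) (Short-upTo 1 rows≤N)))
    where
    rows≤N : 2 + n ≤ N ^ 1
    rows≤N = subst (2 + n ≤_) (sym (*-identityʳ N)) (<⇒≤ 3+n≤N)

  Short-chord-pairs : Short 32 (cartesianProduct allChords allChords)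
  Short-chord-pairs = Short-cartesianProduct 16 16 Short-chords Short-chords

  Short-overlaps : Short 12 (overlaps n)
  Short-overlaps = Short-concatMap 2 10
    (Short-concatMap 1 1 (Short-upTo 1 n≤N) (λ x → Short-map 1 (Short-upTo 1 n≤N))) λ q →
    Short-concatMap 3 7 (Short-keep 3 Short-edges) λ e → Short-concatMap 3 4 (Short-keep 3 Short-edges) λ e' →
    Short-concatMap 2 2 Short-positions λ i → Short-map 2 Short-positions

  Short-clauses : ∀ col s t → Short 13 (Clauses.clauses n col s t)
  Short-clauses col s t = Short-++ 12
    (Short-mono (m≤m+n 8 4)
      (Short-concatMap 2 6 Short-positions λ i → Short-map 6 (Short-distinctPairs 3 Short-edges)))
    (Short-∷ 11 (Short-++ 10
      (Short-mono (m≤m+n 2 8) (Short-map 2 (Short-innerPositions col)))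
    (Short-++ 9
      (Short-mono (m≤m+n 3 6) (Short-map 3 (Short-keep 3 Short-edges)))
    (Short-++ 8
      (Short-concatMap 2 6 (Short-innerPositions col) λ i → Short-concatMap 3 3 Short-edges λ e →
        Short-map 3 (Short-keep 3 Short-edges))
      (Short-mono (m≤m+n 5 3)
        (Short-concatMap 2 3 Short-positions λ i → Short-map 3 (Short-keep 3 Short-edges)))))))
    where open Clauses n col s t

  -- The pairs of chords over which `Unlinked` ranges have the largest bound, `N ^ 32`; one more
  -- factor makes it strict.
  width : ℕ
  width = N ^ 33

  fits : ∀ a {x} → x ≤ N ^ a → a < 33 → x < width
  fits a l a<33 = <-≤-trans (≤-<-trans l (^-monoʳ-< N (<⇒≤ (m+n≤o⇒m≤o 3 3+n≤N)) (n<1+n a))) (^-monoʳ-≤ N a<33)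

  All-map : {P : Form Atom → Set} {f : X → Form Atom} → (∀ x → P (f x)) → (xs : List X) → All P (map f xs)
  All-map p [] = []
  All-map p (x ∷ xs) = p x ∷ All-map p xs

  All-concatMap : {P : Form Atom → Set} {f : X → List (Form Atom)} → (∀ x → All P (f x)) → (xs : List X) →
                  All P (concatMap f xs)
  All-concatMap p [] = []
  All-concatMap p (x ∷ xs) = All.++⁺ (p x) (All-concatMap p xs)

  Bounded-⋁₂ : Bounded width h φ → Bounded width h ψ → Bounded width (suc h) (⋁ (φ ∷ ψ ∷ []))
  Bounded-⋁₂ β β' = ⋁ (fits 1 2≤N¹ (s≤s (s≤s z≤n))) λ
    { (here refl) → β
    ; (there (here refl)) → β' }

  Bounded-occ : ∀ col i → Bounded width 1 (occ n col i)
  Bounded-occ col i = ⋁ (fits 3 (bound (Short-map 3 Short-edges)) (m≤m+n 4 29))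
    (All.lookup (All-map {P = Bounded width 0} (λ _ → pos) (edges n)))

  Bounded-occNext : ∀ col i → Bounded width 1 (occNext n col i)
  Bounded-occNext col i with i <ᵇ n * n
  ... | true = Bounded-occ col (suc i)
  ... | false = ⋁ (fits 0 z≤n (s≤s z≤n)) (λ ())

  Bounded-clauses : ∀ col s t → All (Bounded width 2) (Clauses.clauses n col s t)
  Bounded-clauses col s t =
    All.++⁺ (All-concatMap (λ i → All-map (λ _ → Bounded-⋁₂ neg neg) (distinctPairs (edges n))) (positions n))
    (Bounded-mono (s≤s z≤n) (Bounded-occ col 1) ∷
    All.++⁺ (All-map (λ i → Bounded-⋁₂ (Bounded-dual (Bounded-occ col (suc i))) (Bounded-occ col i)) (innerPositions n col))
    (All.++⁺ (All-map (λ _ → neg) (keep (λ e → not (incident s e)) (edges n)))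
    (All.++⁺ (All-concatMap (λ i → All-concatMap (λ e → All-map (λ _ → Bounded-⋁₂ neg neg)
               (keep (λ e' → not (shareVertex e e')) (edges n))) (edges n)) (innerPositions n col))
    (All-concatMap (λ i → All-map (λ e → Bounded-⋁₂ neg (Bounded-occNext col i))
      (keep (λ e → not (incident t e)) (edges n))) (positions n)))))

  Bounded-isPath : ∀ col s t → Bounded width 3 (isPath n col s t)
  Bounded-isPath col s t = ⋀ (fits 13 (bound (Short-clauses col s t)) (m≤m+n 14 19)) (All.lookup (Bounded-clauses col s t))

  Bounded-overlaps : All (Bounded width 1) (overlaps n)
  Bounded-overlaps =
    All-concatMap (λ q → All-concatMap (λ e → All-concatMap (λ e' → All-concatMap (λ i → All-map (λ j →
      ⋀ (fits 1 2≤N¹ (s≤s (s≤s z≤n))) (All.lookup {P = Bounded width 0} (pos ∷ pos ∷ [])))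
      (positions n)) (positions n)) (keep (incident q) (edges n))) (keep (incident q) (edges n))) (points n)

  Bounded-sharePoint : Bounded width 2 (sharePoint n)
  Bounded-sharePoint = ⋁ (fits 12 (bound Short-overlaps) (m≤m+n 13 20)) (All.lookup Bounded-overlaps)

  Bounded-STSEQ : Bounded width 5 (STSEQ n)
  Bounded-STSEQ = ⋁ (fits 1 3≤N¹ (s≤s (s≤s z≤n))) λ
    { (here refl) → Bounded-mono (n≤1+n 3) (Bounded-dual (Bounded-isPath b (0 , 0) (n ∸ 1 , n ∸ 1)))
    ; (there (here refl)) → Bounded-mono (n≤1+n 3) (Bounded-dual (Bounded-isPath r (0 , n ∸ 1) (n ∸ 1 , 0)))
    ; (there (there (here refl))) → Bounded-mono (s≤s (s≤s z≤n)) Bounded-sharePoint }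

-- For `n` at most 1, the clause that the first position is occupied is an empty disjunction.
no-edges-refutation : ∀ {W} n → edges n ≡ [] → Refutation W 5 65 (dual (STSEQ n) ∷ [])
no-edges-refutation n none = select (here refl) (here refl)
  (select (here (sym (dual-involutive (isPath n b (0 , 0) (n ∸ 1 , n ∸ 1)))))
    (Clauses.occ-clause n b (0 , 0) (n ∸ 1 , n ∸ 1))
    (absurd (here (cong (λ es → ⋁ (map (λ e → pos (b e 1)) es)) (sym none)))))

STSEQ-refutation : ∀ n N → 3 + n ≤ N → Refutation (N ^ 33) 5 65 (dual (STSEQ n) ∷ [])
STSEQ-refutation zero N _ = no-edges-refutation 0 refl
STSEQ-refutation (suc zero) N _ = no-edges-refutation 1 refl
STSEQ-refutation (suc (suc p)) N 5+p≤N = Square.refutation p width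
  (fits 2 (≤-trans (m≤m+n 6 3) (product 1 1 3≤N¹ 3≤N¹)) (m≤m+n 3 30))
  (fits 1 n≤N (m≤m+n 2 31))
  (fits 3 times≤N³ (m≤m+n 4 29))
  (fits 4 (bound Short-states) (m≤m+n 5 28))
  (fits 7 (bound Short-pairs) (m≤m+n 8 25))
  (fits 32 (bound Short-chord-pairs) (m≤m+n 33 0))
  where
  open Sizes (2 + p) N 5+p≤N

-- The polynomial size bound

opaque

  -- The two summands are exponents for the number of lines and for the size of a line. The
  -- definition is opaque because 3 to this power occurs in the result and must not be evaluated.
  degree : (w D h c : ℕ) → ℕ
  degree w D h c = suc (suc (1 + w) * suc h) + suc (c + w * D)

module Polynomial (N : ℕ) (2<N : 2 < N) where

  open Lengths N 2<N

  3≤N^ : ∀ {c} a → c ≤ 3 ^ a → c ≤ N ^ a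
  3≤N^ a l = ≤-trans l (^-monoˡ-≤ a 2<N)

  power : ∀ a c {x} → x ≤ N ^ a → x ^ c ≤ N ^ (a * c)
  power a c l = ≤-trans (^-monoˡ-≤ c l) (≤-reflexive (^-*-assoc N a c))

  successor : ∀ a {x} → x ≤ N ^ a → suc x ≤ N ^ suc a
  successor a = double a (m^n>0 N a)

  opaque
    unfolding degree

    size-bound : ∀ w D h c {C} → C ≤ N ^ c →
                 suc ((3 * N ^ w + 3) ^ suc h) * suc (C * (N ^ w) ^ D) ≤ N ^ degree w D h c
    size-bound w D h c C≤ = product (suc (suc (1 + w) * suc h)) (suc (c + w * D))
      (successor (suc (1 + w) * suc h) (power (suc (1 + w)) (suc h)
        (double (1 + w) (product 1 w 3≤N¹ ≤-refl) (≤-trans 3≤N¹ (^-monoʳ-≤ N {1} {1 + w} (s≤s z≤n))))))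
      (successor (c + w * D) (product c (w * D) C≤ (≤-reflexive (^-*-assoc N w D))))
      where
      3≤N¹ : 3 ≤ N ^ 1
      3≤N¹ = 3≤N^ 1 ≤-refl

  prove-within : ∀ w D h c {φ : Form A} → Refutation (N ^ w) D h (dual φ ∷ []) → Bounded (N ^ w) D φ →
                 1 + 2 * h ≤ N ^ c →
                 Σ (Proof φ) λ π → (proofDepth π ≤ D) × (proofSize π ≤ N ^ degree w D h c)
  prove-within w D h c ρ β l with Translation.prove (N ^ w) D (N ^ c) {{m^n≢0 N w}} ρ β l
  ... | π , d , s = π , d , ≤-trans s (size-bound w D h c ≤-refl)

-- From `3 + n ≤ 3 * suc n`; the base 3 + n, in which constants are absorbed, is traded for a
-- constant factor.
rescale : ∀ n k {x} → x ≤ (3 + n) ^ k → x ≤ 3 ^ k * suc n ^ k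
rescale n k {x} l = begin
  x                    ≤⟨ l ⟩
  (3 + n) ^ k          ≤⟨ ^-monoˡ-≤ k (subst (3 + n ≤_) (sym (*-suc 3 n)) (+-monoʳ-≤ 3 (m≤n*m n 3))) ⟩
  (3 * suc n) ^ k      ≡⟨ *-^ k ⟩
  3 ^ k * suc n ^ k    ∎
  where
  open ≤-Reasoning
  open +-*-Solver
  *-^ : ∀ k → (3 * suc n) ^ k ≡ 3 ^ k * suc n ^ k
  *-^ zero = refl
  *-^ (suc k) = trans (cong (3 * suc n *_) (*-^ k))
    (solve 4 (λ a c x y → (a :* c) :* (x :* y) := (a :* x) :* (c :* y)) refl 3 (suc n) (3 ^ k) (suc n ^ k))

theorem6p2 : Σ ℕ λ d → Σ ℕ λ c → Σ ℕ λ k →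
    (n : ℕ) → Σ (Proof (STSEQ n)) λ π →
    (proofDepth π ≤ d) × (proofSize π ≤ c * suc n ^ k)
theorem6p2 = 5 , 3 ^ degree 33 5 65 5 , degree 33 5 65 5 , λ n → rescaled n (within n (3 + n) ≤-refl)
  where
  within : ∀ n N → 3 + n ≤ N → Σ (Proof (STSEQ n)) λ π → (proofDepth π ≤ 5) × (proofSize π ≤ N ^ degree 33 5 65 5)
  within n N 3+n≤N = prove-within 33 5 65 5 (STSEQ-refutation n N 3+n≤N) (Sizes.Bounded-STSEQ n N 3+n≤N)
                       -- Sequents have length at most 1 + 2 * 65 = 131, and 131 + 112 = 3 ^ 5.
                       (3≤N^ 5 (m≤m+n 131 112))
    where open Polynomial N (m+n≤o⇒m≤o 3 3+n≤N)
  rescaled : ∀ n → (Σ (Proof (STSEQ n)) λ π → (proofDepth π ≤ 5) × (proofSize π ≤ (3 + n) ^ degree 33 5 65 5)) →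
             Σ (Proof (STSEQ n)) λ π → (proofDepth π ≤ 5) × (proofSize π ≤ 3 ^ degree 33 5 65 5 * suc n ^ degree 33 5 65 5)
  rescaled n (π , d , s) = π , d , rescale n (degree 33 5 65 5) s
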